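{- Let $\mathcal{R}$ be a commutative ring with unity such that $i\notin\mathcal{R}$ (that is, $-1$ is not a square in $\mathcal{R}$). Let $\mathcal{S}(\mathcal{R})=\{(x_1,x_2,x_3,x_4)\in\mathcal{R}^4 : x_1^2+x_2^2+x_3^2+x_4^2=1\}$. Define the maps $$\theta:\mathcal{S}(\mathcal{R})\to \mathrm{SU}_2(\mathcal{R}),\qquad \theta(x_1,x_2,x_3,x_4)=\begin{pmatrix} x_1+x_2 i & -x_3+x_4 i\\ x_3+x_4 i & x_1-x_2 i\end{pmatrix},$$ $$\phi:\mathcal{S}(\mathcal{R})\to \mathrm{SO}_4(\mathcal{R}),\qquad \phi(x_1,x_2,x_3,x_4)=\begin{pmatrix} x_1&x_2&x_3&x_4\\ -x_2&x_1&x_4&-x_3\\ -x_3&-x_4&x_1&x_2\\ -x_4&x_3&-x_2&x_1\end{pmatrix}.$$ Then: 1. $\theta$ is a bijection. Hence $\langle\mathcal{S}(\mathcal{R}),\oplus\rangle$ is a non-abelian group, where $\oplus:\mathcal{S}(\mathcal{R})\times\mathcal{S}(\mathcal{R})\to\mathcal{S}(\mathcal{R})$ is given by $X\oplus Y=\theta^{ -1}(\theta(X)\theta(Y))$. 2. $\phi$ is an injective group homomorphism. 3. If $\mathcal{R}=\mathbb{Z}/n$, where $n$ is a positive integer, then there is a short exact sequence $$1\longrightarrow \mathcal{S}(\mathbb{Z}/n)\stackrel{f}{\longrightarrow} U_2(\mathbb{Z}/n)\stackrel{g}{\longrightarrow}(\mathbb{Z}/n)^{\times}\longrightarrow 1$$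 of group homomorphisms.
   Context: $\mathcal{R}[i]$ denotes $\mathcal{R}[t]/(t^2+1)$ with $i$ the class of $t$, so every element is uniquely $a+bi$ with $a,b\in\mathcal{R}$; conjugation is $\overline{a+bi}=a-bi$. $\mathrm{SU}_2(\mathcal{R})$ is the special unitary group of degree $2$ with entries in $\mathcal{R}[i]$, i.e. the group under matrix multiplication of matrices $\begin{pmatrix}\alpha&-\overline{\beta}\\ \beta&\overline{\alpha}\end{pmatrix}$ with $\alpha,\beta\in\mathcal{R}[i]$ and $\alpha\overline{\alpha}+\beta\overline{\beta}=1$. $\mathrm{SO}_4(\mathcal{R})$ is the group of $4\times4$ matrices $M$ over $\mathcal{R}$ with $MM^T=M^TM=I$ and $\det M=1$. In this paper $U_2(\mathbb{Z}/n)$, called the unitary group, denotes the group under matrix multiplication of all invertible matrices of the form $\begin{pmatrix}\alpha&-\overline{\beta}\\ \beta&\overline{\alpha}\end{pmatrix}$ with $\alpha,\beta\in(\mathbb{Z}/n)[i]$ (only invertibility is required, not determinant $1$). $(\mathbb{Z}/n)^\times$ is the group of units of $\mathbb{Z}/n$. -}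

module Defs where

open import Algebra.Bundles
open import Algebra.Bundles.Raw using (RawGroup; RawRing)
import Algebra.Definitions as AlgDefs
import Algebra.Definitions.RawMonoid as RawMonoidDefs
import Algebra.Morphism.Structures as Morphisms
import Algebra.Properties.AbelianGroup as AbelianGroupProperties
import Algebra.Properties.CommutativeSemigroup as CommutativeSemigroupProperties
import Algebra.Properties.Ring as RingProperties
import Algebra.Properties.Semiring.Mult.TCOptimised as Mult
import Algebra.Properties.Semiring.Sum as SumProperties
import Algebra.Solver.Ring
open import Algebra.Solver.Ring.AlmostCommutativeRing using (_-Raw-AlmostCommutative⟶_; fromCommutativeRing)
open import Data.Fin.Base using (Fin; zero; suc; punchIn; combine; _↑ˡ_; _↑ʳ_)
open import Data.Fin.Patterns
open import Data.Integer.Base as ℤ using (ℤ; +_; -[1+_]; 0ℤ; 1ℤ)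
open import Data.Integer.Divisibility.Signed using (_∣_; ∣m∣n⇒∣m+n; ∣m⇒∣-m; ∣n⇒∣m*n; divides)
import Data.Integer.Properties as ℤ
open import Data.Integer.Solver using (module +-*-Solver)
open import Data.Maybe.Base using () renaming (map to mapMaybe)
open import Data.Nat.Base as ℕ using (ℕ; zero; suc)
open import Data.Product using (Σ; ∃; ∃₂; _×_; _,_; proj₁; proj₂)
open import Data.Vec.Base as Vec using ()
open import Data.Vec.Functional using (Vector; _∷_; []; foldr)
open import Function.Base using (_∘_)
open import Function.Bundles using (_⇔_)
open import Function.Definitions using (Injective; Surjective)
open import Level using (Level; _⊔_)
open import Relation.Binary.PropositionalEquality as ≡ using (_≡_)
import Relation.Binary.Reasoning.Setoid as ≈-Reasoning
open import Relation.Nullary.Decidable.Core using (dec⇒maybe)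

-- The constructions below take a RawRing so that they can be applied to
-- a ring and, inside the solver proofs, to its polynomial expressions.

module RawMatrix {a ℓ} (A : RawRing a ℓ) where
  open RawRing A
  open RawMonoidDefs +-rawMonoid using (sum)

  infix  4 _≈ₘ_
  infixl 7 _*ₘ_
  infix  9 _ᵀ

  Matrix : ℕ → ℕ → Set a
  Matrix m n = Vector (Vector Carrier n) m

  _≈ₘ_ : ∀ {m n} → Matrix m n → Matrix m n → Set ℓ
  M ≈ₘ N = ∀ i j → M i j ≈ N i j

  _*ₘ_ : ∀ {m n p} → Matrix m n → Matrix n p → Matrix m p
  (M *ₘ N) i k = sum (λ j → M i j * N j k)

  1ₘ : ∀ {n} → Matrix n n
  1ₘ zero    zero    = 1#
  1ₘ zero    (suc j) = 0#
  1ₘ (suc i) zero    = 0#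
  1ₘ (suc i) (suc j) = 1ₘ i j

  _ᵀ : ∀ {m n} → Matrix m n → Matrix n m
  (M ᵀ) i j = M j i

  minor₀ : ∀ {n} → Matrix (suc n) (suc n) → Fin (suc n) → Matrix n n
  minor₀ M j k l = M (suc k) (punchIn j l)

  -- Laplace expansion along the first row; folding with subtraction
  -- produces the alternating signs: t₀ - (t₁ - (t₂ - ...)).
  det : ∀ {n} → Matrix n n → Carrier
  det {zero}  M = 1#
  det {suc n} M = foldr (λ t s → t + - s) 0# (λ j → M 0F j * det (minor₀ M j))

infix 5 _+i_

-- a +i b stands for the class of a + b t in A[t]/(t² + 1).
record Gauss {a} (A : Set a) : Set a where
  constructor _+i_
  field
    re im : A

open Gauss public

module RawGauss {a ℓ} (A : RawRing a ℓ) where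
  open RawRing A

  gaussRawRing : RawRing a ℓ
  gaussRawRing = record
    { Carrier = Gauss Carrier
    ; _≈_     = λ z w → (re z ≈ re w) × (im z ≈ im w)
    ; _+_     = λ z w → re z + re w +i im z + im w
    ; _*_     = λ z w → re z * re w + - (im z * im w) +i re z * im w + im z * re w
    ; -_      = λ z → - re z +i - im z
    ; 0#      = 0# +i 0#
    ; 1#      = 1# +i 0#
    }

  conj : Gauss Carrier → Gauss Carrier
  conj z = re z +i - im z

  private module G = RawRing gaussRawRing
  open RawMatrix gaussRawRing using (Matrix)

  form : Gauss Carrier → Gauss Carrier → Matrix 2 2
  form α β = (α ∷ G.- conj β ∷ [])
           ∷ (β ∷ conj α     ∷ [])
           ∷ []

  normSq : Gauss Carrier → Gauss Carrier → Gauss Carrier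
  normSq α β = α G.* conj α G.+ β G.* conj β

-- The ring solver for R with integer coefficients.

module IntegerCoefficients {c ℓ} (R : CommutativeRing c ℓ) where
  open CommutativeRing R
  open RingProperties ring using (-‿distribˡ-*; -‿distribʳ-*; -0#≈0#; -‿involutive)
  open AbelianGroupProperties +-abelianGroup using (⁻¹-∙-comm)
  open Mult semiring using (×-homo-+; ×1-homo-*; 1+×) renaming (_×_ to _·_)
  open ≈-Reasoning setoid

  private
    ⟦_⟧ : ℤ → Carrier
    ⟦ + n ⟧      = n · 1#
    ⟦ -[1+ n ] ⟧ = - (suc n · 1#)

    ⟦-⟧ : ∀ x → ⟦ ℤ.- x ⟧ ≈ - ⟦ x ⟧
    ⟦-⟧ (+ zero)   = sym -0#≈0#
    ⟦-⟧ (+ suc n)  = refl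
    ⟦-⟧ -[1+ n ]   = sym (-‿involutive _)

    x+y-[x+z] : ∀ x y z → (x + y) - (x + z) ≈ y - z
    x+y-[x+z] x y z = begin
      (x + y) + - (x + z)     ≈⟨ +-cong (+-comm x y) (sym (⁻¹-∙-comm x z)) ⟩
      (y + x) + (- x + - z)   ≈⟨ +-assoc y x _ ⟩
      y + (x + (- x + - z))   ≈⟨ +-congˡ (sym (+-assoc x _ _)) ⟩
      y + ((x + - x) + - z)   ≈⟨ +-congˡ (+-congʳ (-‿inverseʳ x)) ⟩
      y + (0# + - z)          ≈⟨ +-congˡ (+-identityˡ _) ⟩
      y - z                   ∎

    ⟦⊖⟧ : ∀ m n → ⟦ m ℤ.⊖ n ⟧ ≈ m · 1# - n · 1#
    ⟦⊖⟧ m zero = begin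
      m · 1#          ≈⟨ +-identityʳ _ ⟨
      m · 1# + 0#     ≈⟨ +-congˡ -0#≈0# ⟨
      m · 1# - 0#     ∎
    ⟦⊖⟧ zero (suc n) = sym (+-identityˡ _)
    ⟦⊖⟧ (suc m) (suc n) = begin
      ⟦ suc m ℤ.⊖ suc n ⟧             ≡⟨ ≡.cong ⟦_⟧ (ℤ.[1+m]⊖[1+n]≡m⊖n m n) ⟩
      ⟦ m ℤ.⊖ n ⟧                     ≈⟨ ⟦⊖⟧ m n ⟩
      m · 1# - n · 1#                 ≈⟨ x+y-[x+z] 1# _ _ ⟨
      (1# + m · 1#) - (1# + n · 1#)   ≈⟨ +-cong (sym (1+× m 1#)) (-‿cong (sym (1+× n 1#))) ⟩
      suc m · 1# - suc n · 1#         ∎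

    ⟦+⟧ : ∀ x y → ⟦ x ℤ.+ y ⟧ ≈ ⟦ x ⟧ + ⟦ y ⟧
    ⟦+⟧ (+ m)    (+ n)    = ×-homo-+ 1# m n
    ⟦+⟧ (+ m)    -[1+ n ] = ⟦⊖⟧ m (suc n)
    ⟦+⟧ -[1+ m ] (+ n)    = trans (⟦⊖⟧ n (suc m)) (+-comm _ _)
    ⟦+⟧ -[1+ m ] -[1+ n ] = begin
      - (suc (suc (m ℕ.+ n)) · 1#)          ≡⟨ ≡.cong (λ k → - (k · 1#)) (≡.sym (ℕ-suc m n)) ⟩
      - ((suc m ℕ.+ suc n) · 1#)            ≈⟨ -‿cong (×-homo-+ 1# (suc m) (suc n)) ⟩
      - (suc m · 1# + suc n · 1#)           ≈⟨ ⁻¹-∙-comm _ _ ⟨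
      - (suc m · 1#) + - (suc n · 1#)       ∎
      where
      ℕ-suc : ∀ m n → suc m ℕ.+ suc n ≡ suc (suc (m ℕ.+ n))
      ℕ-suc zero    n = ≡.refl
      ℕ-suc (suc m) n = ≡.cong suc (ℕ-suc m n)

    ⟦*⟧⁺ : ∀ m n → ⟦ + m ℤ.* + n ⟧ ≈ m · 1# * n · 1#
    ⟦*⟧⁺ m n = begin
      ⟦ + m ℤ.* + n ⟧   ≡⟨ ≡.cong ⟦_⟧ (ℤ.pos-* m n) ⟨
      (m ℕ.* n) · 1#    ≈⟨ ×1-homo-* m n ⟩
      m · 1# * n · 1#   ∎

    ⟦*⟧ : ∀ x y → ⟦ x ℤ.* y ⟧ ≈ ⟦ x ⟧ * ⟦ y ⟧
    ⟦*⟧ (+ m) (+ n) = ⟦*⟧⁺ m n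
    ⟦*⟧ (+ m) -[1+ n ] = begin
      ⟦ + m ℤ.* ℤ.- + suc n ⟧       ≡⟨ ≡.cong ⟦_⟧ (ℤ.neg-distribʳ-* (+ m) (+ suc n)) ⟨
      ⟦ ℤ.- (+ m ℤ.* + suc n) ⟧     ≈⟨ ⟦-⟧ (+ m ℤ.* + suc n) ⟩
      - ⟦ + m ℤ.* + suc n ⟧         ≈⟨ -‿cong (⟦*⟧⁺ m (suc n)) ⟩
      - (m · 1# * suc n · 1#)       ≈⟨ -‿distribʳ-* _ _ ⟩
      m · 1# * - (suc n · 1#)       ∎
    ⟦*⟧ -[1+ m ] (+ n) = begin
      ⟦ ℤ.- + suc m ℤ.* + n ⟧       ≡⟨ ≡.cong ⟦_⟧ (ℤ.neg-distribˡ-* (+ suc m) (+ n)) ⟨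
      ⟦ ℤ.- (+ suc m ℤ.* + n) ⟧     ≈⟨ ⟦-⟧ (+ suc m ℤ.* + n) ⟩
      - ⟦ + suc m ℤ.* + n ⟧         ≈⟨ -‿cong (⟦*⟧⁺ (suc m) n) ⟩
      - (suc m · 1# * n · 1#)       ≈⟨ -‿distribˡ-* _ _ ⟩
      - (suc m · 1#) * n · 1#       ∎
    ⟦*⟧ -[1+ m ] -[1+ n ] = begin
      ⟦ + suc m ℤ.* + suc n ⟧             ≈⟨ ⟦*⟧⁺ (suc m) (suc n) ⟩
      suc m · 1# * suc n · 1#             ≈⟨ -‿involutive _ ⟨
      - - (suc m · 1# * suc n · 1#)       ≈⟨ -‿cong (-‿distribʳ-* _ _) ⟩
      - (suc m · 1# * - (suc n · 1#))     ≈⟨ -‿distribˡ-* _ _ ⟩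
      - (suc m · 1#) * - (suc n · 1#)     ∎

    morphism : CommutativeRing.rawRing ℤ.+-*-commutativeRing -Raw-AlmostCommutative⟶ fromCommutativeRing R
    morphism = record
      { ⟦_⟧    = ⟦_⟧
      ; +-homo = ⟦+⟧
      ; *-homo = ⟦*⟧
      ; -‿homo = ⟦-⟧
      ; 0-homo = refl
      ; 1-homo = refl
      }

  open Algebra.Solver.Ring (CommutativeRing.rawRing ℤ.+-*-commutativeRing) (fromCommutativeRing R) morphism
    (λ x y → mapMaybe (λ x≡y → reflexive (≡.cong ⟦_⟧ x≡y)) (dec⇒maybe (x ℤ.≟ y))) public
    using (Polynomial; con; var; _:+_; _:*_; :-_; prove; ⟦_⟧↓)
    renaming (⟦_⟧ to ⟦_⟧ₚ)

  polynomials : ℕ → RawRing _ _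
  polynomials n = record
    { Carrier = Polynomial n
    ; _≈_     = _≡_
    ; _+_     = _:+_
    ; _*_     = _:*_
    ; -_      = :-_
    ; 0#      = con 0ℤ
    ; 1#      = con 1ℤ
    }

-- Multiplicativity of the 4 × 4 determinant, by Laplace expansion along
-- the first two rows and the Cauchy–Binet formula for 2 × 2 minors.

module RawLaplace {a ℓ} (A : RawRing a ℓ) where
  open RawRing A
  open RawMatrix A using (Matrix)

  -- The six pairs (l , r) with l < r; pairs number k and 5 - k are
  -- complementary.
  l r : Fin 6 → Fin 4
  l = 0F ∷ 0F ∷ 0F ∷ 1F ∷ 1F ∷ 2F ∷ []
  r = 1F ∷ 2F ∷ 3F ∷ 2F ∷ 3F ∷ 3F ∷ []

  minors : Vector Carrier 4 → Vector Carrier 4 → Vector Carrier 6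
  minors a b k = a (l k) * b (r k) + - (a (r k) * b (l k))

  laplace : Vector Carrier 6 → Vector Carrier 6 → Carrier
  laplace p q = p 0F * q 5F + - (p 1F * q 4F) + p 2F * q 3F
              + p 3F * q 2F + - (p 4F * q 1F) + p 5F * q 0F

  rows : (a b c d : Vector Carrier 4) → Matrix 4 4
  rows a b c d = a ∷ b ∷ c ∷ d ∷ []

  δ : Fin 6 → Vector Carrier 6
  δ i j = RawMatrix.1ₘ A i j

module Determinant₄ {c ℓ} (R : CommutativeRing c ℓ) where
  open CommutativeRing R
  open RawMatrix rawRing
  open RawLaplace rawRing
  open IntegerCoefficients R
  open SumProperties semiring using (sum; sum-cong-≋)
  open CommutativeSemigroupProperties *-commutativeSemigroup using (x∙yz≈y∙xz)
  open ≈-Reasoning setoid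

  private
    module M₁₆ = RawMatrix (polynomials 16)
    module L₁₆ = RawLaplace (polynomials 16)

    X : M₁₆.Matrix 4 4
    X i j = var (combine i j)

    entries : Matrix 4 4 → Vec.Vec Carrier 16
    entries A = Vec.concat (Vec.tabulate λ i → Vec.tabulate (A i))

    det-laplace : ∀ A → det A ≈ laplace (minors (A 0F) (A 1F)) (minors (A 2F) (A 3F))
    det-laplace A = prove (entries A) (M₁₆.det X)
      (L₁₆.laplace (L₁₆.minors (X 0F) (X 1F)) (L₁₆.minors (X 2F) (X 3F))) refl

    cauchy-binet : ∀ (a b u v : Vector Carrier 4) →
      sum (λ i → a i * u i) * sum (λ i → b i * v i) + - (sum (λ i → a i * v i) * sum (λ i → b i * u i)) ≈
      sum (λ k → minors a b k * (u (l k) * v (r k) + - (v (l k) * u (r k))))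
    cauchy-binet a b u v = prove (entries (rows a b u v))
      (s (X 0F) (X 2F) :* s (X 1F) (X 3F) :+ :- (s (X 0F) (X 3F) :* s (X 1F) (X 2F)))
      (foldr _:+_ (con 0ℤ) (λ k → L₁₆.minors (X 0F) (X 1F) k :* (X 2F (l k) :* X 3F (r k) :+ :- (X 3F (l k) :* X 2F (r k)))))
      refl
      where
      s : (x y : Vector (Polynomial 16) 4) → Polynomial 16
      s x y = foldr _:+_ (con 0ℤ) (λ i → x i :* y i)

    all : ∀ {p} {P : Fin 6 → Set p} → P 0F → P 1F → P 2F → P 3F → P 4F → P 5F → ∀ i → P i
    all a b c d e f 0F = a
    all a b c d e f 1F = b
    all a b c d e f 2F = c
    all a b c d e f 3F = d
    all a b c d e f 4F = e
    all a b c d e f 5F = f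

    sub : ∀ {a} {A : Set a} → Vector (Vector A 4) 4 → Fin 6 → Fin 6 → Vector (Vector A 4) 4
    sub A i j = A (l i) ∷ A (r i) ∷ A (l j) ∷ A (r j) ∷ []

    det-sub : ∀ A i j → det (sub A i j) ≈ laplace (δ i) (δ j) * det A
    det-sub A = all
      (all (e 0F 0F refl) (e 0F 1F refl) (e 0F 2F refl) (e 0F 3F refl) (e 0F 4F refl) (e 0F 5F refl))
      (all (e 1F 0F refl) (e 1F 1F refl) (e 1F 2F refl) (e 1F 3F refl) (e 1F 4F refl) (e 1F 5F refl))
      (all (e 2F 0F refl) (e 2F 1F refl) (e 2F 2F refl) (e 2F 3F refl) (e 2F 4F refl) (e 2F 5F refl))
      (all (e 3F 0F refl) (e 3F 1F refl) (e 3F 2F refl) (e 3F 3F refl) (e 3F 4F refl) (e 3F 5F refl))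
      (all (e 4F 0F refl) (e 4F 1F refl) (e 4F 2F refl) (e 4F 3F refl) (e 4F 4F refl) (e 4F 5F refl))
      (all (e 5F 0F refl) (e 5F 1F refl) (e 5F 2F refl) (e 5F 3F refl) (e 5F 4F refl) (e 5F 5F refl))
      where
      e = λ i j → prove (entries A) (M₁₆.det (sub X i j)) (L₁₆.laplace (L₁₆.δ i) (L₁₆.δ j) :* M₁₆.det X)

    laplace-cong : ∀ {p p′ q q′} → (∀ k → p k ≈ p′ k) → (∀ k → q k ≈ q′ k) → laplace p q ≈ laplace p′ q′
    laplace-cong P Q =
      +-cong (+-cong (+-cong (+-cong (+-cong (*-cong (P 0F) (Q 5F))
        (-‿cong (*-cong (P 1F) (Q 4F)))) (*-cong (P 2F) (Q 3F))) (*-cong (P 3F) (Q 2F)))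
        (-‿cong (*-cong (P 4F) (Q 1F)))) (*-cong (P 5F) (Q 0F))

    laplace-0 : ∀ q → laplace (λ _ → 0#) q ≈ 0#
    laplace-0 q = prove (Vec.tabulate q) (RawLaplace.laplace (polynomials 6) (λ _ → con 0ℤ) var) (con 0ℤ) refl

    laplace-sym : ∀ p q → laplace p q ≈ laplace q p
    laplace-sym p q = prove (Vec.tabulate p Vec.++ Vec.tabulate q)
      (L₁₂.laplace P Q) (L₁₂.laplace Q P) refl
      where
      module L₁₂ = RawLaplace (polynomials 12)
      P Q : Fin 6 → Polynomial 12
      P i = var (i ↑ˡ 6)
      Q i = var (6 ↑ʳ i)

    laplace-linear : ∀ x p p′ q → laplace (λ k → x * p k + p′ k) q ≈ x * laplace p q + laplace p′ q
    laplace-linear x p p′ q = prove (x Vec.∷ Vec.tabulate p Vec.++ Vec.tabulate p′ Vec.++ Vec.tabulate q)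
      (L₁₉.laplace (λ k → var 0F :* P k :+ P′ k) Q) (var 0F :* L₁₉.laplace P Q :+ L₁₉.laplace P′ Q) refl
      where
      module L₁₉ = RawLaplace (polynomials 19)
      P P′ Q : Fin 6 → Polynomial 19
      P i  = var (suc (i ↑ˡ 12))
      P′ i = var (suc (6 ↑ʳ (i ↑ˡ 6)))
      Q i  = var (suc (6 ↑ʳ (6 ↑ʳ i)))

    laplace-sumˡ : ∀ {n} (x : Vector Carrier n) (m : Matrix n 6) q →
      laplace (λ k → sum (λ i → x i * m i k)) q ≈ sum (λ i → x i * laplace (m i) q)
    laplace-sumˡ {zero}  x m q = laplace-0 q
    laplace-sumˡ {suc n} x m q = trans
      (laplace-linear (x 0F) (m 0F) (λ k → sum (λ i → x (suc i) * m (suc i) k)) q)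
      (+-congˡ (laplace-sumˡ (x ∘ suc) (m ∘ suc) q))

    laplace-sumʳ : ∀ {n} (x : Vector Carrier n) (m : Matrix n 6) p →
      laplace p (λ k → sum (λ i → x i * m i k)) ≈ sum (λ i → x i * laplace p (m i))
    laplace-sumʳ x m p = trans (laplace-sym p (λ k → sum (λ i → x i * m i k))) (trans (laplace-sumˡ x m p)
      (sum-cong-≋ (λ i → *-congˡ (laplace-sym (m i) p))))

    laplace-δ : ∀ p q D → sum (λ i → p i * sum (λ j → q j * (laplace (δ i) (δ j) * D))) ≈ laplace p q * D
    laplace-δ p q D = prove (D Vec.∷ Vec.tabulate p Vec.++ Vec.tabulate q)
      (s (λ i → P i :* s (λ j → Q j :* (L₁₃.laplace (L₁₃.δ i) (L₁₃.δ j) :* var 0F)))) (L₁₃.laplace P Q :* var 0F) refl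
      where
      module L₁₃ = RawLaplace (polynomials 13)
      P Q : Fin 6 → Polynomial 13
      P i = var (suc (i ↑ˡ 6))
      Q i = var (suc (6 ↑ʳ i))
      s : Vector (Polynomial 13) 6 → Polynomial 13
      s = foldr _:+_ (con 0ℤ)

  det-* : (M N : Matrix 4 4) → det (M *ₘ N) ≈ det M * det N
  det-* M N = begin
    det (M *ₘ N)
      ≈⟨ det-laplace (M *ₘ N) ⟩
    laplace (minors ((M *ₘ N) 0F) ((M *ₘ N) 1F)) (minors ((M *ₘ N) 2F) ((M *ₘ N) 3F))
      ≈⟨ laplace-cong (λ k → cauchy-binet (M 0F) (M 1F) (λ i → N i (l k)) (λ i → N i (r k)))
                      (λ k → cauchy-binet (M 2F) (M 3F) (λ i → N i (l k)) (λ i → N i (r k))) ⟩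
    laplace (λ k → sum (λ i → P i * m i k)) (λ k → sum (λ i → Q i * m i k))
      ≈⟨ laplace-sumˡ P m (λ k → sum (λ i → Q i * m i k)) ⟩
    sum (λ i → P i * laplace (m i) (λ k → sum (λ j → Q j * m j k)))
      ≈⟨ sum-cong-≋ (λ i → *-congˡ {P i} (laplace-sumʳ Q m (m i))) ⟩
    sum (λ i → P i * sum (λ j → Q j * laplace (m i) (m j)))
      ≈⟨ sum-cong-≋ (λ i → *-congˡ {P i} (sum-cong-≋ (λ j → *-congˡ {Q j}
           (trans (sym (det-laplace (sub N i j))) (det-sub N i j))))) ⟩
    sum (λ i → P i * sum (λ j → Q j * (laplace (δ i) (δ j) * det N)))
      ≈⟨ laplace-δ P Q (det N) ⟩
    laplace P Q * det N
      ≈⟨ *-congʳ (det-laplace M) ⟨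
    det M * det N ∎
    where
    P = minors (M 0F) (M 1F)
    Q = minors (M 2F) (M 3F)
    m = λ i → minors (N (l i)) (N (r i))

  det-ᵀ : (M : Matrix 4 4) → det (M ᵀ) ≈ det M
  det-ᵀ M = prove (entries M) (M₁₆.det (X M₁₆.ᵀ)) (M₁₆.det X) refl

module _ {c ℓ p : Level} (M : Monoid c ℓ) where
  open Monoid M
  open AlgDefs _≈_ using (Invertible)

  -- Carried by the elements satisfying P, together with a proof of P;
  -- equality compares only the elements.
  subgroup : (P : Carrier → Set p)
    (P-∙ : ∀ {x y} → P x → P y → P (x ∙ y))
    (P-ε : P ε)
    (inv : ∀ {x} → P x → Σ (Invertible ε _∙_ x) (P ∘ proj₁)) →
    Group (c ⊔ p) ℓ
  subgroup P P-∙ P-ε inv = record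
    { Carrier = Σ Carrier P
    ; _≈_     = λ x y → proj₁ x ≈ proj₁ y
    ; _∙_     = λ x y → proj₁ x ∙ proj₁ y , P-∙ (proj₂ x) (proj₂ y)
    ; ε       = ε , P-ε
    ; _⁻¹     = λ x → proj₁ (proj₁ (inv (proj₂ x))) , proj₂ (inv (proj₂ x))
    ; isGroup = record
      { isMonoid = record
        { isSemigroup = record
          { isMagma = record
            { isEquivalence = record { refl = refl ; sym = sym ; trans = trans }
            ; ∙-cong        = ∙-cong
            }
          ; assoc = λ x y z → assoc (proj₁ x) (proj₁ y) (proj₁ z)
          }
        ; identity = (λ x → identityˡ (proj₁ x)) , (λ x → identityʳ (proj₁ x))
        }
      ; inverse = (λ x → proj₁ (proj₂ (proj₁ (inv (proj₂ x))))) , (λ x → proj₂ (proj₂ (proj₁ (inv (proj₂ x)))))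
      ; ⁻¹-cong = λ {x} {y} → unique (proj₁ (inv (proj₂ x))) (proj₁ (inv (proj₂ y)))
      }
    }
    where
    open ≈-Reasoning setoid
    unique : ∀ {x y} (u : Invertible ε _∙_ x) (v : Invertible ε _∙_ y) → x ≈ y → proj₁ u ≈ proj₁ v
    unique {x} {y} (u , ux , xu) (v , vy , yv) x≈y = begin
      u           ≈⟨ identityʳ u ⟨
      u ∙ ε       ≈⟨ ∙-congˡ yv ⟨
      u ∙ (y ∙ v) ≈⟨ ∙-congˡ (∙-congʳ x≈y) ⟨
      u ∙ (x ∙ v) ≈⟨ assoc u x v ⟨
      (u ∙ x) ∙ v ≈⟨ ∙-congʳ ux ⟩
      ε ∙ v       ≈⟨ identityˡ v ⟩
      v           ∎

module _ {c ℓ} (M : Monoid c ℓ) where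
  open Monoid M
  open AlgDefs _≈_ using (Invertible)
  open ≈-Reasoning setoid

  invertible-∙ : ∀ {x y} → Invertible ε _∙_ x → Invertible ε _∙_ y → Invertible ε _∙_ (x ∙ y)
  invertible-∙ {x} {y} (u , ux , xu) (v , vy , yv) = v ∙ u , cancel ux vy , cancel yv xu
    where
    cancel : ∀ {a b c d} → a ∙ b ≈ ε → c ∙ d ≈ ε → (c ∙ a) ∙ (b ∙ d) ≈ ε
    cancel {a} {b} {c} {d} ab cd = begin
      (c ∙ a) ∙ (b ∙ d) ≈⟨ assoc c a _ ⟩
      c ∙ (a ∙ (b ∙ d)) ≈⟨ ∙-congˡ (assoc a b d) ⟨
      c ∙ ((a ∙ b) ∙ d) ≈⟨ ∙-congˡ (∙-congʳ ab) ⟩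
      c ∙ (ε ∙ d)       ≈⟨ ∙-congˡ (identityˡ d) ⟩
      c ∙ d             ≈⟨ cd ⟩
      ε                 ∎

  invertible-ε : Invertible ε _∙_ ε
  invertible-ε = ε , identityˡ ε , identityˡ ε

  units : Group (c ⊔ ℓ) ℓ
  units = subgroup M (Invertible ε _∙_) invertible-∙ invertible-ε
    (λ { {x} (y , yx , xy) → (y , yx , xy) , (x , xy , yx) })

module MatrixMonoid {c ℓ} (R : CommutativeRing c ℓ) where
  open CommutativeRing R
  open RawMatrix rawRing
  open SumProperties semiring using (sum; sum-cong-≋; ∑-comm; sum-replicate-zero; *-distribˡ-sum; *-distribʳ-sum)
  open ≈-Reasoning setoid

  private
    sum-1ₘ : ∀ {n} (i : Fin n) (v : Vector Carrier n) → sum (λ j → 1ₘ i j * v j) ≈ v i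
    sum-1ₘ {suc n} zero v = begin
      1# * v 0F + sum (λ j → 0# * v (suc j)) ≈⟨ +-cong (*-identityˡ _) (sum-cong-≋ (λ j → zeroˡ (v (suc j)))) ⟩
      v 0F + sum {n} (λ _ → 0#)              ≈⟨ +-congˡ (sum-replicate-zero n) ⟩
      v 0F + 0#                              ≈⟨ +-identityʳ _ ⟩
      v 0F                                   ∎
    sum-1ₘ (suc i) v = begin
      0# * v 0F + sum (λ j → 1ₘ i j * v (suc j)) ≈⟨ +-cong (zeroˡ _) (sum-1ₘ i (v ∘ suc)) ⟩
      0# + v (suc i)                             ≈⟨ +-identityˡ _ ⟩
      v (suc i)                                  ∎

    1ₘ-sym : ∀ {n} (i j : Fin n) → 1ₘ i j ≡ 1ₘ j i
    1ₘ-sym zero    zero    = ≡.refl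
    1ₘ-sym zero    (suc j) = ≡.refl
    1ₘ-sym (suc i) zero    = ≡.refl
    1ₘ-sym (suc i) (suc j) = 1ₘ-sym i j

    *ₘ-assoc : ∀ {m n p q} (L : Matrix m n) (M : Matrix n p) (N : Matrix p q) → (L *ₘ M) *ₘ N ≈ₘ L *ₘ (M *ₘ N)
    *ₘ-assoc L M N i l = begin
      sum (λ k → sum (λ j → L i j * M j k) * N k l)   ≈⟨ sum-cong-≋ (λ k → *-distribʳ-sum (N k l) (λ j → L i j * M j k)) ⟩
      sum (λ k → sum (λ j → L i j * M j k * N k l))   ≈⟨ ∑-comm (λ k j → L i j * M j k * N k l) ⟩
      sum (λ j → sum (λ k → L i j * M j k * N k l))   ≈⟨ sum-cong-≋ (λ j → sum-cong-≋ (λ k → *-assoc (L i j) (M j k) (N k l))) ⟩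
      sum (λ j → sum (λ k → L i j * (M j k * N k l))) ≈⟨ sum-cong-≋ (λ j → *-distribˡ-sum (L i j) (λ k → M j k * N k l)) ⟨
      sum (λ j → L i j * sum (λ k → M j k * N k l))   ∎

  matrixMonoid : ℕ → Monoid c ℓ
  matrixMonoid n = record
    { Carrier  = Matrix n n
    ; _≈_      = _≈ₘ_
    ; _∙_      = _*ₘ_
    ; ε        = 1ₘ
    ; isMonoid = record
      { isSemigroup = record
        { isMagma = record
          { isEquivalence = record
            { refl  = λ i j → refl
            ; sym   = λ p i j → sym (p i j)
            ; trans = λ p q i j → trans (p i j) (q i j)
            }
          ; ∙-cong = λ p q i k → sum-cong-≋ (λ j → *-cong (p i j) (q j k))
          }
        ; assoc = *ₘ-assoc
        }
      ; identity = (λ M i k → sum-1ₘ i (λ j → M j k))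
                 , (λ M i k → trans (sum-cong-≋ (λ j → trans (*-comm (M i j) (1ₘ j k)) (*-congʳ (reflexive (1ₘ-sym j k)))))
                                    (sum-1ₘ k (M i)))
      }
    }

  ᵀ-*ₘ : ∀ {m n p} (M : Matrix m n) (N : Matrix n p) → (M *ₘ N) ᵀ ≈ₘ N ᵀ *ₘ M ᵀ
  ᵀ-*ₘ M N k i = sum-cong-≋ (λ j → *-comm (M i j) (N j k))

  1ₘᵀ : ∀ {n} → 1ₘ {n} ᵀ ≈ₘ 1ₘ
  1ₘᵀ i j = reflexive (1ₘ-sym j i)

module SpecialOrthogonal {c ℓ} (R : CommutativeRing c ℓ) where
  open CommutativeRing R
  open RawMatrix rawRing
  open MatrixMonoid R
  open Determinant₄ R using (det-*; det-ᵀ)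
  private module M = Monoid (matrixMonoid 4)

  IsSO : ∀ {n} → Matrix n n → Set ℓ
  IsSO M = (M *ₘ M ᵀ ≈ₘ 1ₘ) × (M ᵀ *ₘ M ≈ₘ 1ₘ) × (det M ≈ 1#)

  SO₄ : Group (c ⊔ ℓ) ℓ
  SO₄ = subgroup (matrixMonoid 4) IsSO
    (λ { {M} {N} (MMᵀ , MᵀM , detM) (NNᵀ , NᵀN , detN) →
         M.trans (M.∙-congˡ {M *ₘ N} (ᵀ-*ₘ M N)) (cancel M N (N ᵀ) (M ᵀ) NNᵀ MMᵀ)
       , M.trans (M.∙-congʳ {M *ₘ N} (ᵀ-*ₘ M N)) (cancel (N ᵀ) (M ᵀ) M N MᵀM NᵀN)
       , trans (det-* M N) (trans (*-cong detM detN) (*-identityˡ 1#)) })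
    ( M.trans (M.identityˡ (1ₘ ᵀ)) 1ₘᵀ
    , M.trans (M.identityʳ (1ₘ ᵀ)) 1ₘᵀ
    , det-1)
    (λ { {M} (MMᵀ , MᵀM , detM) → (M ᵀ , MᵀM , MMᵀ) , (MᵀM , MMᵀ , trans (det-ᵀ M) detM) })
    where
    cancel : ∀ A B C D → B *ₘ C ≈ₘ 1ₘ → A *ₘ D ≈ₘ 1ₘ → (A *ₘ B) *ₘ (C *ₘ D) ≈ₘ 1ₘ
    cancel A B C D BC AD = M.trans (M.assoc A B (C *ₘ D)) (M.trans (M.∙-congˡ {A}
      (M.trans (M.sym (M.assoc B C D)) (M.trans (M.∙-congʳ {D} BC) (M.identityˡ D)))) AD)
    det-1 : det (1ₘ {4}) ≈ 1#
    det-1 = prove Vec.[] (RawMatrix.det (polynomials 0) {4} (RawMatrix.1ₘ (polynomials 0))) (con 1ℤ) refl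
      where open IntegerCoefficients R

module Gaussian {c ℓ} (R : CommutativeRing c ℓ) where
  open CommutativeRing R
  open RawGauss rawRing public
  open IntegerCoefficients R
  private
    module G = RawRing gaussRawRing
    module P (n : ℕ) = RawRing (RawGauss.gaussRawRing (polynomials n))

  proveᵍ : ∀ {n} (ρ : Vec.Vec Carrier n) (z w : Gauss (Polynomial n)) →
    (⟦ re z ⟧↓ ρ ≈ ⟦ re w ⟧↓ ρ) × (⟦ im z ⟧↓ ρ ≈ ⟦ im w ⟧↓ ρ) →
    (⟦ re z ⟧ₚ ρ +i ⟦ im z ⟧ₚ ρ) G.≈ (⟦ re w ⟧ₚ ρ +i ⟦ im w ⟧ₚ ρ)
  proveᵍ ρ z w (p , q) = prove ρ (re z) (re w) p , prove ρ (im z) (im w) q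

  private
    z₀ : ∀ {n} → Gauss (Polynomial (2 ℕ.+ n))
    z₀ = var 0F +i var 1F
    z₁ : ∀ {n} → Gauss (Polynomial (4 ℕ.+ n))
    z₁ = var 2F +i var 3F
    z₂ : ∀ {n} → Gauss (Polynomial (6 ℕ.+ n))
    z₂ = var 4F +i var 5F

    ⟨_,_,_⟩ : (u v w : Gauss Carrier) → Vec.Vec Carrier 6
    ⟨ u , v , w ⟩ = re u Vec.∷ im u Vec.∷ re v Vec.∷ im v Vec.∷ re w Vec.∷ im w Vec.∷ Vec.[]

    +-cong′ : ∀ {z z′ w w′} → z G.≈ z′ → w G.≈ w′ → z G.+ w G.≈ z′ G.+ w′
    +-cong′ (a , b) (c , d) = +-cong a c , +-cong b d

    *-cong′ : ∀ {z z′ w w′} → z G.≈ z′ → w G.≈ w′ → z G.* w G.≈ z′ G.* w′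
    *-cong′ (a , b) (c , d) = +-cong (*-cong a c) (-‿cong (*-cong b d)) , +-cong (*-cong a d) (*-cong b c)

    *-comm′ : ∀ z w → z G.* w G.≈ w G.* z
    *-comm′ z w = proveᵍ ⟨ z , w , z ⟩ (z₀ Q.* z₁) (z₁ Q.* z₀) (refl , refl)
      where module Q = P 6

    distribˡ′ : ∀ z w u → z G.* (w G.+ u) G.≈ z G.* w G.+ z G.* u
    distribˡ′ z w u = proveᵍ ⟨ z , w , u ⟩ (z₀ Q.* (z₁ Q.+ z₂)) (z₀ Q.* z₁ Q.+ z₀ Q.* z₂) (refl , refl)
      where module Q = P 6

    distribʳ′ : ∀ z w u → (w G.+ u) G.* z G.≈ w G.* z G.+ u G.* z
    distribʳ′ z w u = proveᵍ ⟨ z , w , u ⟩ ((z₁ Q.+ z₂) Q.* z₀) (z₁ Q.* z₀ Q.+ z₂ Q.* z₀) (refl , refl)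
      where module Q = P 6

  conj-cong : ∀ {z w} → z G.≈ w → conj z G.≈ conj w
  conj-cong (a , b) = a , -‿cong b

  gaussianRing : CommutativeRing c ℓ
  gaussianRing = record
    { Carrier = Gauss Carrier
    ; _≈_ = G._≈_ ; _+_ = G._+_ ; _*_ = G._*_ ; -_ = G.-_ ; 0# = G.0# ; 1# = G.1#
    ; isCommutativeRing = record
      { isRing = record
        { +-isAbelianGroup = record
          { isGroup = record
            { isMonoid = record
              { isSemigroup = record
                { isMagma = record
                  { isEquivalence = record
                    { refl  = refl , refl
                    ; sym   = λ { (p , q) → sym p , sym q }
                    ; trans = λ { (p , q) (p′ , q′) → trans p p′ , trans q q′ }
                    }
                  ; ∙-cong = λ {z} {z′} {w} {w′} → +-cong′ {z} {z′} {w} {w′}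
                  }
                ; assoc = λ z w u → +-assoc _ _ _ , +-assoc _ _ _
                }
              ; identity = (λ z → +-identityˡ _ , +-identityˡ _) , (λ z → +-identityʳ _ , +-identityʳ _)
              }
            ; inverse = (λ z → -‿inverseˡ _ , -‿inverseˡ _) , (λ z → -‿inverseʳ _ , -‿inverseʳ _)
            ; ⁻¹-cong = λ { (p , q) → -‿cong p , -‿cong q }
            }
          ; comm = λ z w → +-comm _ _ , +-comm _ _
          }
        ; *-cong = λ {z} {z′} {w} {w′} → *-cong′ {z} {z′} {w} {w′}
        ; *-assoc = λ z w u → proveᵍ ⟨ z , w , u ⟩ ((z₀ Q.* z₁) Q.* z₂) (z₀ Q.* (z₁ Q.* z₂)) (refl , refl)
        ; *-identity = one , (λ z → trans′ {z G.* G.1#} {G.1# G.* z} {z} (*-comm′ z G.1#) (one z))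
        ; distrib = distribˡ′ , distribʳ′
        }
      ; *-comm = *-comm′
      }
    }
    where
    module Q = P 6
    trans′ : ∀ {u v w} → u G.≈ v → v G.≈ w → u G.≈ w
    trans′ (p , q) (p′ , q′) = trans p p′ , trans q q′
    one : ∀ z → G.1# G.* z G.≈ z
    one z = proveᵍ ⟨ z , z , z ⟩ (Q.1# Q.* z₀) z₀ (refl , refl)

module Unitary {c ℓ} (R : CommutativeRing c ℓ) where
  open Gaussian R public
  open RawMatrix gaussRawRing

  private
    module R = CommutativeRing R
    module G = CommutativeRing gaussianRing
    module M = Monoid (MatrixMonoid.matrixMonoid gaussianRing 2)
    module AP = AlgDefs M._≈_
    module P (n : ℕ) where
      open RawRing (RawGauss.gaussRawRing (IntegerCoefficients.polynomials R n)) public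
      open RawGauss (IntegerCoefficients.polynomials R n) public using () renaming (conj to conjₚ; form to formₚ; normSq to normSqₚ)
      open RawMatrix (RawGauss.gaussRawRing (IntegerCoefficients.polynomials R n)) public using () renaming (det to detₚ; _*ₘ_ to _⊗_; 1ₘ to 𝟙)
    module P₅ = P 5
    module P₈ = P 8

  IsForm : Matrix 2 2 → Set (c ⊔ ℓ)
  IsForm M = ∃₂ λ α β → M ≈ₘ form α β

  IsSU₂ : Matrix 2 2 → Set (c ⊔ ℓ)
  IsSU₂ M = ∃₂ λ α β → (M ≈ₘ form α β) × (normSq α β G.≈ G.1#)

  -- Only invertibility in the ring of 2 × 2 matrices over R[i] is required;
  -- U₂ below shows that the inverse again has the given form.
  IsU₂ : Matrix 2 2 → Set (c ⊔ ℓ)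
  IsU₂ M = IsForm M × AP.Invertible 1ₘ _*ₘ_ M

  private
    C : Set c
    C = G.Carrier

    env₈ : (α β γ δ : C) → Vec.Vec R.Carrier 8
    env₈ α β γ δ = re α Vec.∷ im α Vec.∷ re β Vec.∷ im β Vec.∷ re γ Vec.∷ im γ Vec.∷ re δ Vec.∷ im δ Vec.∷ Vec.[]

    env₅ : (α β : C) → R.Carrier → Vec.Vec R.Carrier 5
    env₅ α β p = re α Vec.∷ im α Vec.∷ re β Vec.∷ im β Vec.∷ p Vec.∷ Vec.[]

    real : R.Carrier → C
    real p = p +i R.0#

    open IntegerCoefficients R using (Polynomial; var; con)

    α₈ β₈ γ₈ δ₈ : Gauss (Polynomial 8)
    α₈ = var 0F +i var 1F
    β₈ = var 2F +i var 3F
    γ₈ = var 4F +i var 5F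
    δ₈ = var 6F +i var 7F

    α₅ β₅ p₅ : Gauss (Polynomial 5)
    α₅ = var 0F +i var 1F
    β₅ = var 2F +i var 3F
    p₅ = var 4F +i con 0ℤ

    2×2 : ∀ {p} {P : Fin 2 → Fin 2 → Set p} → P 0F 0F → P 0F 1F → P 1F 0F → P 1F 1F → ∀ i j → P i j
    2×2 a b c d 0F 0F = a
    2×2 a b c d 0F 1F = b
    2×2 a b c d 1F 0F = c
    2×2 a b c d 1F 1F = d

    rr : ∀ {x y} → (x R.≈ x) × (y R.≈ y)
    rr = R.refl , R.refl

    form-* : ∀ α β γ δ → form α β *ₘ form γ δ ≈ₘ form (α G.* γ G.+ G.- (conj β G.* δ)) (β G.* γ G.+ conj α G.* δ)
    form-* α β γ δ = 2×2 (e 0F 0F rr) (e 0F 1F rr) (e 1F 0F rr) (e 1F 1F rr)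
      where
      open P₈
      e = λ i j → proveᵍ (env₈ α β γ δ) ((formₚ α₈ β₈ ⊗ formₚ γ₈ δ₈) i j)
            (formₚ (α₈ * γ₈ + - (conjₚ β₈ * δ₈)) (β₈ * γ₈ + conjₚ α₈ * δ₈) i j)

    normSq-* : ∀ α β γ δ → normSq (α G.* γ G.+ G.- (conj β G.* δ)) (β G.* γ G.+ conj α G.* δ) G.≈ normSq α β G.* normSq γ δ
    normSq-* α β γ δ = proveᵍ (env₈ α β γ δ)
      (normSqₚ (α₈ * γ₈ + - (conjₚ β₈ * δ₈)) (β₈ * γ₈ + conjₚ α₈ * δ₈)) (normSqₚ α₈ β₈ * normSqₚ γ₈ δ₈) rr
      where open P₈

    adj : C → C → R.Carrier → Matrix 2 2
    adj α β p = form (real p G.* conj α) (real p G.* (G.- β))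

    module _ (α β : C) (p : R.Carrier) (pν≈1 : real p G.* normSq α β G.≈ G.1#) where
      private
        scale : (i j : Fin 2) → (real p G.* normSq α β) G.* 1ₘ i j G.≈ 1ₘ i j
        scale i j = G.trans (G.*-congʳ {1ₘ i j} pν≈1) (G.*-identityˡ (1ₘ i j))

      adjʳ : form α β *ₘ adj α β p ≈ₘ 1ₘ
      adjʳ i j = G.trans (2×2 {P = λ i j → (form α β *ₘ adj α β p) i j G.≈ (real p G.* normSq α β) G.* 1ₘ i j}
          (e 0F 0F rr) (e 0F 1F rr) (e 1F 0F rr) (e 1F 1F rr) i j) (scale i j)
        where
        open P₅
        e = λ i j → proveᵍ (env₅ α β p) ((formₚ α₅ β₅ ⊗ formₚ (p₅ * conjₚ α₅) (p₅ * - β₅)) i j) ((p₅ * normSqₚ α₅ β₅) * 𝟙 i j)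

      adjˡ : adj α β p *ₘ form α β ≈ₘ 1ₘ
      adjˡ i j = G.trans (2×2 {P = λ i j → (adj α β p *ₘ form α β) i j G.≈ (real p G.* normSq α β) G.* 1ₘ i j}
          (e 0F 0F rr) (e 0F 1F rr) (e 1F 0F rr) (e 1F 1F rr) i j) (scale i j)
        where
        open P₅
        e = λ i j → proveᵍ (env₅ α β p) ((formₚ (p₅ * conjₚ α₅) (p₅ * - β₅) ⊗ formₚ α₅ β₅) i j) ((p₅ * normSqₚ α₅ β₅) * 𝟙 i j)

    normSq-adj : ∀ α β → normSq (real R.1# G.* conj α) (real R.1# G.* (G.- β)) G.≈ normSq α β
    normSq-adj α β = proveᵍ (env₅ α β R.0#)
      (normSqₚ (1# * conjₚ α₅) (1# * - β₅)) (normSqₚ α₅ β₅) rr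
      where open P₅

    form-1 : form G.1# G.0# ≈ₘ 1ₘ
    form-1 = 2×2 (e 0F 0F rr) (e 0F 1F rr) (e 1F 0F rr) (e 1F 1F rr)
      where
      open P 0
      e = λ i j → proveᵍ Vec.[] (formₚ 1# 0# i j) (𝟙 i j)

    normSq-1 : normSq G.1# G.0# G.≈ G.1#
    normSq-1 = proveᵍ Vec.[] (normSqₚ 1# 0#) 1# rr
      where open P 0

    det₂-cong : {M N : Matrix 2 2} → M ≈ₘ N → det M G.≈ det N
    det₂-cong {M} {N} M≈N = begin
      det M                                     ≈⟨ det₂ M ⟩
      M 0F 0F G.* M 1F 1F G.- M 0F 1F G.* M 1F 0F ≈⟨ G.+-cong (G.*-cong (M≈N 0F 0F) (M≈N 1F 1F))
                                                      (G.-‿cong (G.*-cong (M≈N 0F 1F) (M≈N 1F 0F))) ⟩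
      N 0F 0F G.* N 1F 1F G.- N 0F 1F G.* N 1F 0F ≈⟨ det₂ N ⟨
      det N                                     ∎
      where
      open ≈-Reasoning G.setoid
      det₂ : ∀ M → det M G.≈ M 0F 0F G.* M 1F 1F G.- M 0F 1F G.* M 1F 0F
      det₂ M = proveᵍ (env₈ (M 0F 0F) (M 0F 1F) (M 1F 0F) (M 1F 1F))
        (P₈.detₚ ((α₈ ∷ β₈ ∷ []) ∷ (γ₈ ∷ δ₈ ∷ []) ∷ [])) (α₈ P₈.* δ₈ P₈.+ P₈.- (β₈ P₈.* γ₈)) rr

    det₂-*form : ∀ M α β → det (M *ₘ form α β) G.≈ det M G.* normSq α β
    det₂-*form M α β = proveᵍ
      (env₈ (M 0F 0F) (M 0F 1F) (M 1F 0F) (M 1F 1F) Vec.++ (re α Vec.∷ im α Vec.∷ re β Vec.∷ im β Vec.∷ Vec.[]))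
      (detₚ (X ⊗ formₚ a b)) (detₚ X * normSqₚ a b) rr
      where
      open P 12
      v : Fin 6 → Gauss (Polynomial 12)
      v i = var (combine {6} {2} i 0F) +i var (combine {6} {2} i 1F)
      X : Fin 2 → Fin 2 → Gauss (Polynomial 12)
      X = (v 0F ∷ v 1F ∷ []) ∷ (v 2F ∷ v 3F ∷ []) ∷ []
      a = v 4F
      b = v 5F

    det₂-1 : det (1ₘ {2}) G.≈ G.1#
    det₂-1 = proveᵍ Vec.[] (detₚ {2} 𝟙) 1# rr
      where open P 0

    -- q · ν = 1 in R[i] with ν = normSq α β ∈ R implies Re(q) · ν = 1.
    real-inverse : ∀ q α β → q G.* normSq α β G.≈ G.1# → real (re q) G.* normSq α β G.≈ G.1#
    real-inverse q α β (qν≈1 , _) = G.trans {real (re q) G.* normSq α β} {re (q G.* normSq α β) +i R.0#}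
      (proveᵍ (env₈ α β q q) ((re γ₈ +i con 0ℤ) * normSqₚ α₈ β₈) (re (γ₈ * normSqₚ α₈ β₈) +i con 0ℤ) rr)
      (qν≈1 , R.refl)
      where open P₈

  SU₂ : Group (c ⊔ ℓ) ℓ
  SU₂ = subgroup (MatrixMonoid.matrixMonoid gaussianRing 2) IsSU₂
    (λ { {M} {N} (α , β , M≈ , ν) (γ , δ , N≈ , ν′) →
      _ , _ , M.trans {M *ₘ N} (M.∙-cong {M} {form α β} {N} {form γ δ} M≈ N≈) (form-* α β γ δ)
      , G.trans (normSq-* α β γ δ) (G.trans (G.*-cong ν ν′) (G.*-identityˡ G.1#)) })
    (_ , _ , M.sym form-1 , normSq-1)
    (λ { {M} (α , β , M≈ , ν) →
      let 1ν = G.trans (G.*-identityˡ (normSq α β)) ν in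
      (adj α β R.1#
      , M.trans (M.∙-congˡ {adj α β R.1#} M≈) (adjˡ α β R.1# 1ν)
      , M.trans (M.∙-congʳ {adj α β R.1#} M≈) (adjʳ α β R.1# 1ν))
      , _ , _ , M.refl , G.trans (normSq-adj α β) ν })

  U₂ : Group (c ⊔ ℓ) ℓ
  U₂ = subgroup (MatrixMonoid.matrixMonoid gaussianRing 2) IsU₂
    (λ { {M} {N} ((α , β , M≈) , Mⁱ) ((γ , δ , N≈) , Nⁱ) →
      (_ , _ , M.trans {M *ₘ N} (M.∙-cong {M} {form α β} {N} {form γ δ} M≈ N≈) (form-* α β γ δ))
      , invertible-∙ (MatrixMonoid.matrixMonoid gaussianRing 2) {M} {N} Mⁱ Nⁱ })
    ((_ , _ , M.sym form-1) , invertible-ε (MatrixMonoid.matrixMonoid gaussianRing 2))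
    (λ { {M} ((α , β , M≈) , (N , NM , MN)) →
      let N·form = M.trans (M.∙-congˡ {N} (M.sym M≈)) NM
          q = re (det N)
          qν = real-inverse (det N) α β (G.trans (G.sym (det₂-*form N α β)) (G.trans (det₂-cong N·form) det₂-1))
      in (N , NM , MN)
      , (_ , _ , (begin
           N                                  ≈⟨ M.identityʳ N ⟨
           N *ₘ 1ₘ                            ≈⟨ M.∙-congˡ {N} (adjʳ α β q qν) ⟨
           N *ₘ (form α β *ₘ adj α β q)       ≈⟨ M.assoc N (form α β) (adj α β q) ⟨
           (N *ₘ form α β) *ₘ adj α β q       ≈⟨ M.∙-congʳ {adj α β q} N·form ⟩
           1ₘ *ₘ adj α β q                    ≈⟨ M.identityˡ (adj α β q) ⟩
           adj α β q                          ∎))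
      , (M , MN , NM) })
    where open ≈-Reasoning M.setoid

module RawMaps {a ℓ} (A : RawRing a ℓ) where
  open RawRing A
  open RawGauss A using (gaussRawRing)

  θ-matrix : (x₁ x₂ x₃ x₄ : Carrier) → RawMatrix.Matrix gaussRawRing 2 2
  θ-matrix x₁ x₂ x₃ x₄ =
      ((x₁ +i x₂) ∷ (- x₃ +i x₄) ∷ [])
    ∷ ((x₃ +i x₄) ∷ (x₁ +i - x₂) ∷ [])
    ∷ []

  φ-matrix : (x₁ x₂ x₃ x₄ : Carrier) → RawMatrix.Matrix A 4 4
  φ-matrix x₁ x₂ x₃ x₄ =
      (  x₁ ∷   x₂ ∷   x₃ ∷   x₄ ∷ [])
    ∷ (- x₂ ∷   x₁ ∷   x₄ ∷ - x₃ ∷ [])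
    ∷ (- x₃ ∷ - x₄ ∷   x₁ ∷   x₂ ∷ [])
    ∷ (- x₄ ∷   x₃ ∷ - x₂ ∷   x₁ ∷ [])
    ∷ []

module Sphere {c ℓ} (R : CommutativeRing c ℓ) where
  open CommutativeRing R
  open RawMatrix rawRing
  open RawMaps rawRing
  open Unitary R
  open SpecialOrthogonal R
  private
    module SU₂ = Group SU₂
    module SO₄ = Group SO₄
    open IntegerCoefficients R

  record 𝒮 : Set (c ⊔ ℓ) where
    field
      x₁ x₂ x₃ x₄ : Carrier
      unit        : x₁ * x₁ + x₂ * x₂ + x₃ * x₃ + x₄ * x₄ ≈ 1#

  infix 4 _≈ˢ_
  _≈ˢ_ : 𝒮 → 𝒮 → Set ℓ
  X ≈ˢ Y = (X.x₁ ≈ Y.x₁) × (X.x₂ ≈ Y.x₂) × (X.x₃ ≈ Y.x₃) × (X.x₄ ≈ Y.x₄)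
    where
    module X = 𝒮 X
    module Y = 𝒮 Y

  private
    module P₄ = RawMaps (polynomials 4)
    module Q₄ = RawMatrix (polynomials 4)
    φₚ : Q₄.Matrix 4 4
    φₚ = P₄.φ-matrix (var 0F) (var 1F) (var 2F) (var 3F)
    νₚ : Polynomial 4
    νₚ = var 0F :* var 0F :+ var 1F :* var 1F :+ var 2F :* var 2F :+ var 3F :* var 3F

    4×4 : ∀ {p} {P : Fin 4 → Fin 4 → Set p} →
      P 0F 0F → P 0F 1F → P 0F 2F → P 0F 3F → P 1F 0F → P 1F 1F → P 1F 2F → P 1F 3F →
      P 2F 0F → P 2F 1F → P 2F 2F → P 2F 3F → P 3F 0F → P 3F 1F → P 3F 2F → P 3F 3F → ∀ i j → P i j
    4×4 a b c d e f g h i j k l m n o p = λ where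
      0F 0F → a ; 0F 1F → b ; 0F 2F → c ; 0F 3F → d
      1F 0F → e ; 1F 1F → f ; 1F 2F → g ; 1F 3F → h
      2F 0F → i ; 2F 1F → j ; 2F 2F → k ; 2F 3F → l
      3F 0F → m ; 3F 1F → n ; 3F 2F → o ; 3F 3F → p

  module _ (X : 𝒮) where
    open 𝒮 X
    private
      ρ : Vec.Vec Carrier 4
      ρ = x₁ Vec.∷ x₂ Vec.∷ x₃ Vec.∷ x₄ Vec.∷ Vec.[]

      ν : Carrier
      ν = x₁ * x₁ + x₂ * x₂ + x₃ * x₃ + x₄ * x₄

      scale : ∀ {n} (i j : Fin n) → ν * 1ₘ i j ≈ 1ₘ i j
      scale i j = trans (*-congʳ unit) (*-identityˡ _)

      φφᵀ : φ-matrix x₁ x₂ x₃ x₄ *ₘ φ-matrix x₁ x₂ x₃ x₄ ᵀ ≈ₘ 1ₘ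
      φφᵀ i j = trans (4×4 {P = λ i j → (φ-matrix x₁ x₂ x₃ x₄ *ₘ φ-matrix x₁ x₂ x₃ x₄ ᵀ) i j ≈ ν * 1ₘ i j}
          (e 0F 0F refl) (e 0F 1F refl) (e 0F 2F refl) (e 0F 3F refl)
          (e 1F 0F refl) (e 1F 1F refl) (e 1F 2F refl) (e 1F 3F refl)
          (e 2F 0F refl) (e 2F 1F refl) (e 2F 2F refl) (e 2F 3F refl)
          (e 3F 0F refl) (e 3F 1F refl) (e 3F 2F refl) (e 3F 3F refl) i j) (scale i j)
        where e = λ i j → prove ρ ((φₚ Q₄.*ₘ φₚ Q₄.ᵀ) i j) (νₚ :* Q₄.1ₘ i j)

      φᵀφ : φ-matrix x₁ x₂ x₃ x₄ ᵀ *ₘ φ-matrix x₁ x₂ x₃ x₄ ≈ₘ 1ₘ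
      φᵀφ i j = trans (4×4 {P = λ i j → (φ-matrix x₁ x₂ x₃ x₄ ᵀ *ₘ φ-matrix x₁ x₂ x₃ x₄) i j ≈ ν * 1ₘ i j}
          (e 0F 0F refl) (e 0F 1F refl) (e 0F 2F refl) (e 0F 3F refl)
          (e 1F 0F refl) (e 1F 1F refl) (e 1F 2F refl) (e 1F 3F refl)
          (e 2F 0F refl) (e 2F 1F refl) (e 2F 2F refl) (e 2F 3F refl)
          (e 3F 0F refl) (e 3F 1F refl) (e 3F 2F refl) (e 3F 3F refl) i j) (scale i j)
        where e = λ i j → prove ρ ((φₚ Q₄.ᵀ Q₄.*ₘ φₚ) i j) (νₚ :* Q₄.1ₘ i j)

      det-φ : det (φ-matrix x₁ x₂ x₃ x₄) ≈ 1#
      det-φ = trans (prove ρ (Q₄.det φₚ) (νₚ :* νₚ) refl) (trans (*-cong unit unit) (*-identityˡ 1#))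

    θ : SU₂.Carrier
    θ = θ-matrix x₁ x₂ x₃ x₄ , x₁ +i x₂ , x₃ +i x₄
      , (λ where
          0F 0F → refl , refl
          0F 1F → refl , prove ρ (var 3F) (:- (:- var 3F)) refl
          1F 0F → refl , refl
          1F 1F → refl , refl)
      , trans (prove ρ (re νᵍ) νₚ refl) unit
      , prove ρ (im νᵍ) (con 0ℤ) refl
      where νᵍ = RawGauss.normSq (polynomials 4) (var 0F +i var 1F) (var 2F +i var 3F)

    φ : SO₄.Carrier
    φ = φ-matrix x₁ x₂ x₃ x₄ , φφᵀ , φᵀφ , det-φ

  θ⁻¹ : SU₂.Carrier → 𝒮
  θ⁻¹ (M , α , β , M≈form , ν≈1) = record
    { x₁   = re (M 0F 0F)
    ; x₂   = im (M 0F 0F)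
    ; x₃   = re (M 1F 0F)
    ; x₄   = im (M 1F 0F)
    ; unit = begin
        sq (re (M 0F 0F)) + sq (im (M 0F 0F)) + sq (re (M 1F 0F)) + sq (im (M 1F 0F))
          ≈⟨ +-cong (+-cong (+-cong (sq-cong (proj₁ (M≈form 0F 0F))) (sq-cong (proj₂ (M≈form 0F 0F))))
               (sq-cong (proj₁ (M≈form 1F 0F)))) (sq-cong (proj₂ (M≈form 1F 0F))) ⟩
        sq (re α) + sq (im α) + sq (re β) + sq (im β)
          ≈⟨ prove (re α Vec.∷ im α Vec.∷ re β Vec.∷ im β Vec.∷ Vec.[]) νₚ
               (re (RawGauss.normSq (polynomials 4) (var 0F +i var 1F) (var 2F +i var 3F))) refl ⟩
        re (normSq α β)
          ≈⟨ proj₁ ν≈1 ⟩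
        1# ∎
    }
    where
    open ≈-Reasoning setoid
    sq : Carrier → Carrier
    sq x = x * x
    sq-cong : ∀ {x y} → x ≈ y → sq x ≈ sq y
    sq-cong p = *-cong p p

  infixl 7 _⊕_
  _⊕_ : 𝒮 → 𝒮 → 𝒮
  X ⊕ Y = θ⁻¹ (θ X SU₂.∙ θ Y)

  -- The structure of SU₂ transported along θ⁻¹; that it satisfies the
  -- group laws is not part of this definition.
  𝒮-rawGroup : RawGroup (c ⊔ ℓ) ℓ
  𝒮-rawGroup = record
    { Carrier = 𝒮
    ; _≈_     = _≈ˢ_
    ; _∙_     = _⊕_
    ; ε       = θ⁻¹ SU₂.ε
    ; _⁻¹     = λ X → θ⁻¹ (θ X SU₂.⁻¹)
    }

IsSquare : ∀ {c ℓ} (R : CommutativeRing c ℓ) → CommutativeRing.Carrier R → Set (c ⊔ ℓ)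
IsSquare R a = ∃ λ x → x * x ≈ a
  where open CommutativeRing R

-- ℤ/n is carried by ℤ with congruence modulo n as its equality.
infix 4 _≡_[mod_]
_≡_[mod_] : ℤ → ℤ → ℕ → Set
x ≡ y [mod n ] = + n ∣ x ℤ.- y

ℤ/_ : ℕ → CommutativeRing _ _
ℤ/ n = record
  { Carrier = ℤ
  ; _≈_ = _≡_[mod n ]
  ; _+_ = ℤ._+_ ; _*_ = ℤ._*_ ; -_ = ℤ.-_ ; 0# = 0ℤ ; 1# = 1ℤ
  ; isCommutativeRing = record
    { isRing = record
      { +-isAbelianGroup = record
        { isGroup = record
          { isMonoid = record
            { isSemigroup = record
              { isMagma = record
                { isEquivalence = record
                  { refl  = λ {x} → ≡⇒≡ₙ {x} ≡.refl
                  ; sym   = λ {x} {y} p → ∣-resp (swap x y) (∣m⇒∣-m p)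
                  ; trans = λ {x} {y} {z} p q → ∣-resp (chain x y z) (∣m∣n⇒∣m+n p q)
                  }
                ; ∙-cong = λ {x} {y} {u} {v} p q → ∣-resp (add x y u v) (∣m∣n⇒∣m+n p q)
                }
              ; assoc = λ x y z → ≡⇒≡ₙ (ℤ.+-assoc x y z)
              }
            ; identity = (λ x → ≡⇒≡ₙ (ℤ.+-identityˡ x)) , (λ x → ≡⇒≡ₙ (ℤ.+-identityʳ x))
            }
          ; inverse = (λ x → ≡⇒≡ₙ (ℤ.+-inverseˡ x)) , (λ x → ≡⇒≡ₙ (ℤ.+-inverseʳ x))
          ; ⁻¹-cong = λ {x} {y} p → ∣-resp (neg x y) (∣m⇒∣-m p)
          }
        ; comm = λ x y → ≡⇒≡ₙ (ℤ.+-comm x y)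
        }
      ; *-cong = λ {x} {y} {u} {v} p q → ∣-resp (mul x y u v) (∣m∣n⇒∣m+n (∣n⇒∣m*n u p) (∣n⇒∣m*n y q))
      ; *-assoc = λ x y z → ≡⇒≡ₙ (ℤ.*-assoc x y z)
      ; *-identity = (λ x → ≡⇒≡ₙ (ℤ.*-identityˡ x)) , (λ x → ≡⇒≡ₙ (ℤ.*-identityʳ x))
      ; distrib = (λ x y z → ≡⇒≡ₙ (ℤ.*-distribˡ-+ x y z)) , (λ x y z → ≡⇒≡ₙ (ℤ.*-distribʳ-+ x y z))
      }
    ; *-comm = λ x y → ≡⇒≡ₙ (ℤ.*-comm x y)
    }
  }
  where
  open +-*-Solver
  ≡⇒≡ₙ : ∀ {x y} → x ≡ y → x ≡ y [mod n ]
  ≡⇒≡ₙ {x} ≡.refl = divides 0ℤ (ℤ.+-inverseʳ x)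
  ∣-resp : ∀ {x y} → x ≡ y → + n ∣ x → + n ∣ y
  ∣-resp ≡.refl p = p
  swap : ∀ x y → ℤ.- (x ℤ.- y) ≡ y ℤ.- x
  swap = solve 2 (λ x y → :- (x :- y) := y :- x) ≡.refl
  chain : ∀ x y z → (x ℤ.- y) ℤ.+ (y ℤ.- z) ≡ x ℤ.- z
  chain = solve 3 (λ x y z → (x :- y) :+ (y :- z) := x :- z) ≡.refl
  add : ∀ x y u v → (x ℤ.- y) ℤ.+ (u ℤ.- v) ≡ (x ℤ.+ u) ℤ.- (y ℤ.+ v)
  add = solve 4 (λ x y u v → (x :- y) :+ (u :- v) := (x :+ u) :- (y :+ v)) ≡.refl
  neg : ∀ x y → ℤ.- (x ℤ.- y) ≡ ℤ.- x ℤ.- ℤ.- y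
  neg = solve 2 (λ x y → :- (x :- y) := (:- x) :- (:- y)) ≡.refl
  mul : ∀ x y u v → u ℤ.* (x ℤ.- y) ℤ.+ y ℤ.* (u ℤ.- v) ≡ x ℤ.* u ℤ.- y ℤ.* v
  mul = solve 4 (λ x y u v → u :* (x :- y) :+ y :* (u :- v) := x :* u :- y :* v) ≡.refl

record ShortExactSequence {g₁ g₂ h₁ h₂ k₁ k₂}
  (G : RawGroup g₁ g₂) (H : RawGroup h₁ h₂) (K : RawGroup k₁ k₂)
  : Set (g₁ ⊔ g₂ ⊔ h₁ ⊔ h₂ ⊔ k₁ ⊔ k₂) where
  private
    module G = RawGroup G
    module H = RawGroup H
    module K = RawGroup K
  -- Exactness at G and at K is injectivity of f and surjectivity of g.
  field
    f              : G.Carrier → H.Carrier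
    g              : H.Carrier → K.Carrier
    f-homomorphism : Morphisms.GroupMorphisms.IsGroupHomomorphism G H f
    g-homomorphism : Morphisms.GroupMorphisms.IsGroupHomomorphism H K g
    f-injective    : Injective G._≈_ H._≈_ f
    exact          : ∀ h → (g h K.≈ K.ε) ⇔ (∃ λ x → f x H.≈ h)
    g-surjective   : Surjective H._≈_ K._≈_ g

{-# OPTIONS --safe #-}

-- θ identifies S(R) with SU₂(R), so the group laws are pulled back along it;
-- φ is multiplicative by a polynomial identity in the eight coordinates, and
-- X is the first row of φ(X).  The quaternions i and j commute only if
-- 2 = 0, and then -1 = 1² is a square.  In the exact sequence g is the
-- determinant αᾱ + ββ̄, whose kernel is SU₂.  Its surjectivity says that
-- every unit of ℤ/n is a sum of four squares, which follows from Lagrange's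
-- theorem: by Euler's identity it suffices to treat primes p; the pigeonhole
-- principle represents a multiple m p with 0 < m < p, and descent on m gives
-- m = 1.
module Submission where

open import Algebra.Bundles using (CommutativeRing; Group; Monoid)
open import Algebra.Bundles.Raw using (RawGroup)
open import Algebra.Definitions using (Commutative)
import Algebra.Definitions
import Algebra.Morphism.GroupMonomorphism as GroupMonomorphism
open import Algebra.Morphism.Structures using (module GroupMorphisms)
import Algebra.Properties.Group
open import Algebra.Structures using (IsGroup)
open import Data.Fin.Base using (Fin; toℕ; fromℕ<; splitAt; join)
open import Data.Fin.Patterns
import Data.Fin.Properties as Fin
open import Data.Integer.Base as ℤ using (ℤ; +_; ∣_∣; 0ℤ; 1ℤ)
open import Data.Integer.DivMod using (_%ℕ_; _/ℕ_; n%ℕd<d; a≡a%ℕn+[a/ℕn]*n)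
open import Data.Integer.Divisibility.Signed
  using (_∣_; divides; ∣⇒∣ᵤ; ∣ᵤ⇒∣; ∣-refl; ∣m∣n⇒∣m+n; ∣m⇒∣-m; ∣m⇒∣m*n)
import Data.Integer.Properties as ℤ
open import Data.Integer.Solver using (module +-*-Solver)
open import Data.List.Relation.Unary.All using (All; []; _∷_)
open import Data.Nat.Base as ℕ using (ℕ; NonZero; zero; suc; z≤n; s≤s; z<s; s<s)
open import Data.Nat.Divisibility as ℕ using () renaming (_∣_ to _∣ᵤ_)
open import Data.Nat.DivMod using (m≡m%n+[m/n]*n; m%n<n)
open import Data.Nat.Induction using (<-rec)
open import Data.Nat.ListAction using (product)
open import Data.Nat.Primality using (Prime; euclidsLemma; prime⇒irreducible; ¬prime[1])
open import Data.Nat.Primality.Factorisation using (factorise; PrimeFactorisation)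
import Data.Nat.Properties as ℕ
import Data.Nat.Solver
open import Data.Product using (_×_; _,_; proj₁; proj₂; ∃; ∃₂)
import Data.Sign.Properties as Sign
open import Data.Sum.Base using (_⊎_; inj₁; inj₂; [_,_]′)
open import Data.Vec.Base as Vec using (Vec)
open import Function.Base using (_∘_)
open import Function.Bundles using (mk⇔)
open import Function.Definitions using (Bijective; Congruent; Injective; Inverseᵇ; Surjective)
open import Level using (_⊔_)
open import Relation.Binary.PropositionalEquality as ≡ using (_≡_; _≢_)
import Relation.Binary.Reasoning.Setoid as ≈-Reasoning
open import Relation.Nullary.Decidable using (yes; no)
open import Relation.Nullary.Negation using (¬_; contradiction)
open import Defs
open Sphere
open Unitary using (SU₂; U₂)
open SpecialOrthogonal using (SO₄)

-- Lagrange's four-square theorem and its form modulo n.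

IsSumOfFourSquares : ∀ {c ℓ} (R : CommutativeRing c ℓ) → CommutativeRing.Carrier R → Set (c ⊔ ℓ)
IsSumOfFourSquares R u =
  ∃ λ x₁ → ∃ λ x₂ → ∃ λ x₃ → ∃ λ x₄ → x₁ * x₁ + x₂ * x₂ + x₃ * x₃ + x₄ * x₄ ≈ u
  where open CommutativeRing R

module FourSquareTheorem where
  open ≡ using (refl)
  open +-*-Solver
  private module ℕˢ = Data.Nat.Solver.+-*-Solver
  open import Data.Integer.Base using (_+_; _*_; _-_; -_; _⊖_)

  FourSquares : ℤ → Set
  FourSquares = IsSumOfFourSquares ℤ.+-*-commutativeRing

  -- Euler's identity and products of sums of four squares.

  private
    norm : (x₁ x₂ x₃ x₄ : ℤ) → ℤ
    norm x₁ x₂ x₃ x₄ = x₁ * x₁ + x₂ * x₂ + x₃ * x₃ + x₄ * x₄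

    dot : (x₁ x₂ x₃ x₄ y₁ y₂ y₃ y₄ : ℤ) → ℤ
    dot x₁ x₂ x₃ x₄ y₁ y₂ y₃ y₄ = x₁ * y₁ + x₂ * y₂ + x₃ * y₃ + x₄ * y₄

    wedge : (a b c d a′ b′ c′ d′ : ℤ) → ℤ
    wedge a b c d a′ b′ c′ d′ = a * b′ - b * a′ + (c * d′ - d * c′)

    -- Euler's four-square identity, with the real part of the
    -- quaternion product x̄y shifted by r.
    euler : ∀ r x₁ x₂ x₃ x₄ y₁ y₂ y₃ y₄ →
      FourSquares (r * r + + 2 * r * dot x₁ x₂ x₃ x₄ y₁ y₂ y₃ y₄ + norm x₁ x₂ x₃ x₄ * norm y₁ y₂ y₃ y₄)
    euler r x₁ x₂ x₃ x₄ y₁ y₂ y₃ y₄ =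
        r + dot x₁ x₂ x₃ x₄ y₁ y₂ y₃ y₄ , wedge x₁ x₂ x₃ x₄ y₁ y₂ y₃ y₄
      , wedge x₁ x₃ x₄ x₂ y₁ y₃ y₄ y₂ , wedge x₁ x₄ x₂ x₃ y₁ y₄ y₂ y₃
      , solve 9 (λ r x₁ x₂ x₃ x₄ y₁ y₂ y₃ y₄ →
          normₚ (r :+ dotₚ x₁ x₂ x₃ x₄ y₁ y₂ y₃ y₄) (wedgeₚ x₁ x₂ x₃ x₄ y₁ y₂ y₃ y₄)
                (wedgeₚ x₁ x₃ x₄ x₂ y₁ y₃ y₄ y₂) (wedgeₚ x₁ x₄ x₂ x₃ y₁ y₄ y₂ y₃)
          := r :* r :+ con (+ 2) :* r :* dotₚ x₁ x₂ x₃ x₄ y₁ y₂ y₃ y₄ :+ normₚ x₁ x₂ x₃ x₄ :* normₚ y₁ y₂ y₃ y₄)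
          refl r x₁ x₂ x₃ x₄ y₁ y₂ y₃ y₄
      where
      normₚ : (x₁ x₂ x₃ x₄ : Polynomial 9) → Polynomial 9
      normₚ x₁ x₂ x₃ x₄ = x₁ :* x₁ :+ x₂ :* x₂ :+ x₃ :* x₃ :+ x₄ :* x₄
      dotₚ wedgeₚ : (x₁ x₂ x₃ x₄ y₁ y₂ y₃ y₄ : Polynomial 9) → Polynomial 9
      dotₚ x₁ x₂ x₃ x₄ y₁ y₂ y₃ y₄ = x₁ :* y₁ :+ x₂ :* y₂ :+ x₃ :* y₃ :+ x₄ :* y₄
      wedgeₚ a b c d a′ b′ c′ d′ = a :* b′ :- b :* a′ :+ (c :* d′ :- d :* c′)

  fourSquares-* : ∀ {m n} → FourSquares m → FourSquares n → FourSquares (m * n)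
  fourSquares-* (x₁ , x₂ , x₃ , x₄ , refl) (y₁ , y₂ , y₃ , y₄ , refl) =
    -- With the shift `r` equal to 0, both terms containing `r` compute to 0.
    ≡.subst FourSquares (ℤ.+-identityˡ _) (euler 0ℤ x₁ x₂ x₃ x₄ y₁ y₂ y₃ y₄)

  -- Centred residues and Fermat's descent.

  centredResidue : ∀ m .{{_ : NonZero m}} x → ∃₂ λ y q → x ≡ y + q * + m × 2 ℕ.* ∣ y ∣ ℕ.≤ m
  centredResidue m x with 2 ℕ.* (x %ℕ m) ℕ.≤? m
  ... | yes 2r≤m = + (x %ℕ m) , x /ℕ m , a≡a%ℕn+[a/ℕn]*n x m , 2r≤m
  -- A remainder above m/2 is shifted down by `m`. The bound is not strict because m/2 itself can
  -- occur for even `m`; this is the source of the upper extremal case in the descent.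
  ... | no  2r≰m = r ⊖ m , q + 1ℤ , eq , bound
    where
    r = x %ℕ m
    q = x /ℕ m
    eq : x ≡ r ⊖ m + (q + 1ℤ) * + m
    eq = begin
      x                             ≡⟨ a≡a%ℕn+[a/ℕn]*n x m ⟩
      + r + q * + m                 ≡⟨ solve 3 (λ r q m → r :+ q :* m := (r :- m) :+ (q :+ con 1ℤ) :* m) refl (+ r) q (+ m) ⟩
      + r - + m + (q + 1ℤ) * + m    ≡⟨ ≡.cong (_+ (q + 1ℤ) * + m) (ℤ.m-n≡m⊖n r m) ⟩
      r ⊖ m + (q + 1ℤ) * + m        ∎
      where open ≡.≡-Reasoning
    bound : 2 ℕ.* ∣ r ⊖ m ∣ ℕ.≤ m
    bound = begin
      2 ℕ.* ∣ r ⊖ m ∣        ≡⟨ ≡.cong (2 ℕ.*_) (ℤ.∣⊖∣-≤ (ℕ.<⇒≤ (n%ℕd<d x m))) ⟩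
      2 ℕ.* (m ℕ.∸ r)        ≡⟨ ℕ.*-distribˡ-∸ 2 m r ⟩
      2 ℕ.* m ℕ.∸ 2 ℕ.* r    ≤⟨ ℕ.∸-monoʳ-≤ (2 ℕ.* m) (ℕ.≰⇒≥ 2r≰m) ⟩
      2 ℕ.* m ℕ.∸ m          ≡⟨ ℕ.m+n∸m≡n m (m ℕ.+ 0) ⟩
      m ℕ.+ 0                ≡⟨ ℕ.+-identityʳ m ⟩
      m                      ∎
      where open ℕ.≤-Reasoning

  i*i≡∣i∣*∣i∣ : ∀ i → i * i ≡ + (∣ i ∣ ℕ.* ∣ i ∣)
  i*i≡∣i∣*∣i∣ i rewrite Sign.s*s≡+ (ℤ.sign i) = ℤ.+◃n≡+n _

  private
    sq : ℕ → ℕ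
    sq t = t ℕ.* t

    normℕ : (a b c d : ℕ) → ℕ
    normℕ a b c d = sq a ℕ.+ sq b ℕ.+ sq c ℕ.+ sq d

  +-tight : ∀ {a b c d} → a ℕ.≤ c → b ℕ.≤ d → a ℕ.+ b ≡ c ℕ.+ d → a ≡ c × b ≡ d
  +-tight {a} a≤c b≤d a+b≡c+d with ℕ.m≤n⇒m<n∨m≡n a≤c
  ... | inj₁ a<c  = contradiction a+b≡c+d (ℕ.<⇒≢ (ℕ.+-mono-<-≤ a<c b≤d))
  ... | inj₂ refl = refl , ℕ.+-cancelˡ-≡ a _ _ a+b≡c+d

  sq-tight : ∀ {a b} → a ℕ.≤ b → sq a ≡ sq b → a ≡ b
  sq-tight a≤b a²≡b² with ℕ.m≤n⇒m<n∨m≡n a≤b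
  ... | inj₁ a<b = contradiction a²≡b² (ℕ.<⇒≢ (ℕ.*-mono-< a<b a<b))
  ... | inj₂ a≡b = a≡b

  sq-mono : ∀ {a b} → a ℕ.≤ b → sq a ℕ.≤ sq b
  sq-mono a≤b = ℕ.*-mono-≤ a≤b a≤b

  normℕ-mono : ∀ {a b c d a′ b′ c′ d′} → a ℕ.≤ a′ → b ℕ.≤ b′ → c ℕ.≤ c′ → d ℕ.≤ d′ → normℕ a b c d ℕ.≤ normℕ a′ b′ c′ d′
  normℕ-mono p q r s = ℕ.+-mono-≤ (ℕ.+-mono-≤ (ℕ.+-mono-≤ (sq-mono p) (sq-mono q)) (sq-mono r)) (sq-mono s)

  -- Each summand is monotone, so one strict inequality between entries would make the sums differ;
  -- `+-tight` peels off the summands one at a time.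
  normℕ-tight : ∀ {a b c d a′ b′ c′ d′} → a ℕ.≤ a′ → b ℕ.≤ b′ → c ℕ.≤ c′ → d ℕ.≤ d′ →
    normℕ a b c d ≡ normℕ a′ b′ c′ d′ → a ≡ a′ × b ≡ b′ × c ≡ c′ × d ≡ d′
  normℕ-tight p q r s eq =
    let (eq₃ , eqᵈ) = +-tight (ℕ.+-mono-≤ (ℕ.+-mono-≤ (sq-mono p) (sq-mono q)) (sq-mono r)) (sq-mono s) eq
        (eq₂ , eqᶜ) = +-tight (ℕ.+-mono-≤ (sq-mono p) (sq-mono q)) (sq-mono r) eq₃
        (eqᵃ , eqᵇ) = +-tight (sq-mono p) (sq-mono q) eq₂
    in sq-tight p eqᵃ , sq-tight q eqᵇ , sq-tight r eqᶜ , sq-tight s eqᵈ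

  -- A sum at either extreme forces all entries to be 0 or all to be `m`. Both extremes are recorded
  -- as a common value `k` divisible by `m`, so that the descent refutes them together.
  norm-bounds : ∀ {m a b c d} → a ℕ.≤ m → b ℕ.≤ m → c ℕ.≤ m → d ℕ.≤ m →
    (∃ λ k → m ∣ᵤ k × a ≡ k × b ≡ k × c ≡ k × d ≡ k) ⊎ (0 ℕ.< normℕ a b c d × normℕ a b c d ℕ.< normℕ m m m m)
  norm-bounds {m} a≤ b≤ c≤ d≤ with ℕ.m≤n⇒m<n∨m≡n (ℕ.z≤n) | ℕ.m≤n⇒m<n∨m≡n (normℕ-mono a≤ b≤ c≤ d≤)
  ... | inj₁ 0<  | inj₁ <4m²  = inj₂ (0< , <4m²)
  ... | inj₁ _   | inj₂ ≡4m²  = inj₁ (m , ℕ.∣-refl , normℕ-tight a≤ b≤ c≤ d≤ ≡4m²)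
  ... | inj₂ 0≡  | _          = inj₁ (0 , m ℕ.∣0 ,
    let (p , q , r , s) = normℕ-tight z≤n z≤n z≤n z≤n 0≡ in ≡.sym p , ≡.sym q , ≡.sym r , ≡.sym s)

  -- With xᵢ ≡ yᵢ mod m, |2yᵢ| ≤ m and ∑ yᵢ² = m r: either 0 < r < m, or
  -- |2yᵢ| is 0 for all i or m for all i, and then m ∣ p.
  descent : ∀ {p m} → Prime p → 1 ℕ.< m → m ℕ.< p → FourSquares (+ m * + p) →
    ∃ λ r → 0 ℕ.< r × r ℕ.< m × FourSquares (+ r * + p)
  descent {p} {m} p-prime 1<m m<p (x₁ , x₂ , x₃ , x₄ , ∑x²≡mp)
    with y₁ , q₁ , refl , y₁≤ ← centredResidue m {{ℕ.>-nonZero (ℕ.<-trans z<s 1<m)}} x₁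
       | y₂ , q₂ , refl , y₂≤ ← centredResidue m {{ℕ.>-nonZero (ℕ.<-trans z<s 1<m)}} x₂
       | y₃ , q₃ , refl , y₃≤ ← centredResidue m {{ℕ.>-nonZero (ℕ.<-trans z<s 1<m)}} x₃
       | y₄ , q₄ , refl , y₄≤ ← centredResidue m {{ℕ.>-nonZero (ℕ.<-trans z<s 1<m)}} x₄
    = [ (λ extremal → contradiction (m∣p extremal) m∤p) , positive ]′ (norm-bounds y₁≤ y₂≤ y₃≤ y₄≤)
    where
    instance _ = ℕ.>-nonZero (ℕ.<-trans z<s 1<m)
    Y = norm y₁ y₂ y₃ y₄
    Q = norm q₁ q₂ q₃ q₄
    D = dot q₁ q₂ q₃ q₄ y₁ y₂ y₃ y₄
    -- Inserting xᵢ = yᵢ + qᵢ m into ∑ xᵢ² = m p gives Y = m (p - (2 D + m Q)), so the cofactor of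
    -- `m` in `Y` is available without a division.
    r = + p - (+ 2 * D + + m * Q)

    ∑[y+qm]² : norm (y₁ + q₁ * + m) (y₂ + q₂ * + m) (y₃ + q₃ * + m) (y₄ + q₄ * + m) ≡ Y + + m * (+ 2 * D + + m * Q)
    ∑[y+qm]² = solve 9 (λ m y₁ y₂ y₃ y₄ q₁ q₂ q₃ q₄ →
        (y₁ :+ q₁ :* m) :* (y₁ :+ q₁ :* m) :+ (y₂ :+ q₂ :* m) :* (y₂ :+ q₂ :* m)
        :+ (y₃ :+ q₃ :* m) :* (y₃ :+ q₃ :* m) :+ (y₄ :+ q₄ :* m) :* (y₄ :+ q₄ :* m)
        := y₁ :* y₁ :+ y₂ :* y₂ :+ y₃ :* y₃ :+ y₄ :* y₄
        :+ m :* (con (+ 2) :* (q₁ :* y₁ :+ q₂ :* y₂ :+ q₃ :* y₃ :+ q₄ :* y₄)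
          :+ m :* (q₁ :* q₁ :+ q₂ :* q₂ :+ q₃ :* q₃ :+ q₄ :* q₄)))
      refl (+ m) y₁ y₂ y₃ y₄ q₁ q₂ q₃ q₄

    mr≡Y : + m * r ≡ Y
    mr≡Y = begin
      + m * r                                          ≡⟨ solve 3 (λ m p z → m :* (p :- z) := m :* p :- m :* z) refl (+ m) (+ p) z ⟩
      + m * + p - + m * z                              ≡⟨ ≡.cong (_- + m * z) (≡.trans (≡.sym ∑x²≡mp) ∑[y+qm]²) ⟩
      Y + + m * z - + m * z                            ≡⟨ solve 2 (λ y w → y :+ w :- w := y) refl Y (+ m * z) ⟩
      Y                                                ∎
      where
      open ≡.≡-Reasoning
      z = + 2 * D + + m * Q

    -- The classical argument divides the quaternion y x̄, of norm m² r p, by m. Since x = y + m q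
    -- and Y = m r, that quotient is r + y q̄; Euler's identity, shifted by `r` and applied to the
    -- qᵢ and yᵢ, produces it directly. Its norm is r² + 2 r D + Q Y = r (r + 2 D + m Q) = r p.
    rp-fourSquares : FourSquares (r * + p)
    rp-fourSquares = ≡.subst FourSquares (begin
      r * r + + 2 * r * D + Q * Y             ≡⟨ ≡.cong (λ y → r * r + + 2 * r * D + Q * y) mr≡Y ⟨
      r * r + + 2 * r * D + Q * (+ m * r)     ≡⟨ solve 4 (λ p m d q → let r = p :- (con (+ 2) :* d :+ m :* q) in
                                                   r :* r :+ con (+ 2) :* r :* d :+ q :* (m :* r) := r :* p)
                                                   refl (+ p) (+ m) D Q ⟩
      r * + p                                 ∎) (euler r q₁ q₂ q₃ q₄ y₁ y₂ y₃ y₄)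
      where open ≡.≡-Reasoning

    -- Restates m r = Y in the doubled absolute values, which are the natural numbers that
    -- `norm-bounds` compares with `m`.
    4mr≡∑[2y]² : + (4 ℕ.* m) * r ≡ + normℕ (2 ℕ.* ∣ y₁ ∣) (2 ℕ.* ∣ y₂ ∣) (2 ℕ.* ∣ y₃ ∣) (2 ℕ.* ∣ y₄ ∣)
    4mr≡∑[2y]² = begin
      + (4 ℕ.* m) * r     ≡⟨ ≡.cong (_* r) (ℤ.pos-* 4 m) ⟩
      + 4 * + m * r       ≡⟨ ℤ.*-assoc (+ 4) (+ m) r ⟩
      + 4 * (+ m * r)     ≡⟨ ≡.cong (+ 4 *_) mr≡Y ⟩
      + 4 * Y             ≡⟨ solve 4 (λ a b c d → con (+ 4) :* (a :+ b :+ c :+ d)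
                               := con (+ 4) :* a :+ con (+ 4) :* b :+ con (+ 4) :* c :+ con (+ 4) :* d)
                               refl (y₁ * y₁) (y₂ * y₂) (y₃ * y₃) (y₄ * y₄) ⟩
      + 4 * (y₁ * y₁) + + 4 * (y₂ * y₂) + + 4 * (y₃ * y₃) + + 4 * (y₄ * y₄)
                          ≡⟨ ≡.cong₂ _+_ (≡.cong₂ _+_ (≡.cong₂ _+_ (e y₁) (e y₂)) (e y₃)) (e y₄) ⟩
      + normℕ (2 ℕ.* ∣ y₁ ∣) (2 ℕ.* ∣ y₂ ∣) (2 ℕ.* ∣ y₃ ∣) (2 ℕ.* ∣ y₄ ∣) ∎
      where
      open ≡.≡-Reasoning
      e : ∀ y → + 4 * (y * y) ≡ + sq (2 ℕ.* ∣ y ∣)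
      e y = begin
        + 4 * (y * y)                  ≡⟨ solve 1 (λ y → con (+ 4) :* (y :* y) := (con (+ 2) :* y) :* (con (+ 2) :* y)) refl y ⟩
        (+ 2 * y) * (+ 2 * y)          ≡⟨ i*i≡∣i∣*∣i∣ (+ 2 * y) ⟩
        + sq ∣ + 2 * y ∣               ≡⟨ ≡.cong (+_ ∘ sq) (ℤ.abs-* (+ 2) y) ⟩
        + sq (2 ℕ.* ∣ y ∣)             ∎

    ∣2y∣≡k⇒m∣2y : ∀ {k} → m ∣ᵤ k → ∀ y → 2 ℕ.* ∣ y ∣ ≡ k → + m ∣ + 2 * y
    ∣2y∣≡k⇒m∣2y m∣k y refl = ∣ᵤ⇒∣ (≡.subst (m ∣ᵤ_) (≡.sym (ℤ.abs-* (+ 2) y)) m∣k)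

    -- If every 2|yᵢ| equals k = c m, then 4 m r = 4 k² and hence r = c k, a multiple of `m`. In p =
    -- r + 2 D + m Q the middle term is ∑ (2 yᵢ) qᵢ, so `m` divides all three terms.
    m∣p : _ → m ∣ᵤ p
    m∣p (k , m∣k@(ℕ.divides c k≡cm) , e₁ , e₂ , e₃ , e₄) = ∣⇒∣ᵤ (≡.subst (+ m ∣_) p≡
      (∣m∣n⇒∣m+n (∣m∣n⇒∣m+n m∣r (∣m∣n⇒∣m+n (∣m∣n⇒∣m+n (∣m∣n⇒∣m+n
        (∣m⇒∣m*n q₁ (∣2y∣≡k⇒m∣2y m∣k y₁ e₁)) (∣m⇒∣m*n q₂ (∣2y∣≡k⇒m∣2y m∣k y₂ e₂)))
        (∣m⇒∣m*n q₃ (∣2y∣≡k⇒m∣2y m∣k y₃ e₃))) (∣m⇒∣m*n q₄ (∣2y∣≡k⇒m∣2y m∣k y₄ e₄))))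
        (∣m⇒∣m*n Q ∣-refl)))
      where
      p≡ : r + (+ 2 * y₁ * q₁ + + 2 * y₂ * q₂ + + 2 * y₃ * q₃ + + 2 * y₄ * q₄) + + m * Q ≡ + p
      p≡ = solve 11 (λ p m Q y₁ y₂ y₃ y₄ q₁ q₂ q₃ q₄ →
          (p :- (con (+ 2) :* (q₁ :* y₁ :+ q₂ :* y₂ :+ q₃ :* y₃ :+ q₄ :* y₄) :+ m :* Q))
          :+ (con (+ 2) :* y₁ :* q₁ :+ con (+ 2) :* y₂ :* q₂ :+ con (+ 2) :* y₃ :* q₃ :+ con (+ 2) :* y₄ :* q₄)
          :+ m :* Q := p)
        refl (+ p) (+ m) Q y₁ y₂ y₃ y₄ q₁ q₂ q₃ q₄
      r≡ck : r ≡ + (c ℕ.* k)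
      r≡ck = ℤ.*-cancelˡ-≡ (+ (4 ℕ.* m)) r (+ (c ℕ.* k)) {{ℕ.m*n≢0 4 m}} (begin
        + (4 ℕ.* m) * r             ≡⟨ 4mr≡∑[2y]² ⟩
        + normℕ (2 ℕ.* ∣ y₁ ∣) (2 ℕ.* ∣ y₂ ∣) (2 ℕ.* ∣ y₃ ∣) (2 ℕ.* ∣ y₄ ∣)
          ≡⟨ ≡.cong +_ (≡.cong₂ ℕ._+_ (≡.cong₂ ℕ._+_ (≡.cong₂ ℕ._+_ (≡.cong sq e₁) (≡.cong sq e₂)) (≡.cong sq e₃)) (≡.cong sq e₄)) ⟩
        + normℕ k k k k             ≡⟨ ≡.cong +_ (4k²≡4mck k≡cm) ⟩
        + (4 ℕ.* m ℕ.* (c ℕ.* k))   ≡⟨ ℤ.pos-* (4 ℕ.* m) (c ℕ.* k) ⟩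
        + (4 ℕ.* m) * + (c ℕ.* k)   ∎)
        where
        open ≡.≡-Reasoning
        4k²≡4mck : ∀ {k} → k ≡ c ℕ.* m → normℕ k k k k ≡ 4 ℕ.* m ℕ.* (c ℕ.* k)
        4k²≡4mck refl = ℕˢ.solve 2 (λ m c → let k = c ℕˢ.:* m; k² = k ℕˢ.:* k in
          k² ℕˢ.:+ k² ℕˢ.:+ k² ℕˢ.:+ k² ℕˢ.:= ℕˢ.con 4 ℕˢ.:* m ℕˢ.:* (c ℕˢ.:* k)) refl m c
      m∣r : + m ∣ r
      m∣r = ≡.subst (+ m ∣_) (≡.sym r≡ck) (∣ᵤ⇒∣ (ℕ.∣n⇒∣m*n c m∣k))

    m∤p : m ℕ.∤ p
    m∤p m∣p = [ (λ { refl → contradiction 1<m (ℕ.<-irrefl refl) }) , (λ { refl → contradiction m<p (ℕ.<-irrefl refl) }) ]′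
      (prime⇒irreducible p-prime m∣p)

    positive : _ → ∃ λ r → 0 ℕ.< r × r ℕ.< m × FourSquares (+ r * + p)
    positive (0<∑ , ∑<4m²) = ∣ r ∣ , ℤ.drop‿+<+ (≡.subst (0ℤ ℤ.<_) (≡.sym +∣r∣≡r) 0<r)
      , ℤ.drop‿+<+ (≡.subst (ℤ._< + m) (≡.sym +∣r∣≡r) r<m)
      , ≡.subst (λ r → FourSquares (r * + p)) (≡.sym +∣r∣≡r) rp-fourSquares
      where
      0<r : 0ℤ ℤ.< r
      0<r = ℤ.*-cancelˡ-<-nonNeg (+ (4 ℕ.* m)) (≡.subst₂ ℤ._<_ (≡.sym (ℤ.*-zeroʳ (+ (4 ℕ.* m)))) (≡.sym 4mr≡∑[2y]²) (ℤ.+<+ 0<∑))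
      r<m : r ℤ.< + m
      r<m = ℤ.*-cancelˡ-<-nonNeg (+ (4 ℕ.* m)) (≡.subst₂ ℤ._<_ (≡.sym 4mr≡∑[2y]²)
        (≡.trans (≡.cong +_ (ℕˢ.solve 1 (λ m → m ℕˢ.:* m ℕˢ.:+ m ℕˢ.:* m ℕˢ.:+ m ℕˢ.:* m ℕˢ.:+ m ℕˢ.:* m ℕˢ.:= ℕˢ.con 4 ℕˢ.:* m ℕˢ.:* m) refl m))
          (ℤ.pos-* (4 ℕ.* m) m)) (ℤ.+<+ ∑<4m²))
      +∣r∣≡r : + ∣ r ∣ ≡ r
      +∣r∣≡r = ℤ.0≤i⇒+∣i∣≡i (ℤ.<⇒≤ 0<r)

  -- Well-founded induction on `m`: each descent keeps the cofactor positive and makes it smaller,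
  -- until it is 1.
  multiple⇒fourSquares : ∀ {p m} → Prime p → 0 ℕ.< m → m ℕ.< p → FourSquares (+ m * + p) → FourSquares (+ p)
  multiple⇒fourSquares {p} p-prime = <-rec
    (λ m → 0 ℕ.< m → m ℕ.< p → FourSquares (+ m * + p) → FourSquares (+ p)) step _
    where
    step : ∀ m → (∀ {r} → r ℕ.< m → 0 ℕ.< r → r ℕ.< p → FourSquares (+ r * + p) → FourSquares (+ p)) →
      0 ℕ.< m → m ℕ.< p → FourSquares (+ m * + p) → FourSquares (+ p)
    step 1 _ _ _ ∑≡p = ≡.subst FourSquares (ℤ.*-identityˡ (+ p)) ∑≡p
    step m@(suc (suc _)) rec _ m<p ∑≡mp with r , 0<r , r<m , ∑≡rp ← descent p-prime (s<s z<s) m<p ∑≡mp =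
      rec r<m 0<r (ℕ.<-trans r<m m<p) ∑≡rp

  -- A small multiple of an odd prime, by the pigeonhole principle.

  %ℕ-≡⇒∣ : ∀ {n} .{{_ : NonZero n}} i j → i %ℕ n ≡ j %ℕ n → + n ∣ i - j
  %ℕ-≡⇒∣ {n} i j i≡j = divides (i /ℕ n - j /ℕ n) (begin
    i - j
      ≡⟨ ≡.cong₂ _-_ (a≡a%ℕn+[a/ℕn]*n i n) (a≡a%ℕn+[a/ℕn]*n j n) ⟩
    (+ (i %ℕ n) + i /ℕ n * + n) - (+ (j %ℕ n) + j /ℕ n * + n)
      ≡⟨ ≡.cong (λ r → (+ r + i /ℕ n * + n) - (+ (j %ℕ n) + j /ℕ n * + n)) i≡j ⟩
    (+ (j %ℕ n) + i /ℕ n * + n) - (+ (j %ℕ n) + j /ℕ n * + n)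
      ≡⟨ solve 4 (λ r q q′ n → (r :+ q :* n) :- (r :+ q′ :* n) := (q :- q′) :* n) refl (+ (j %ℕ n)) (i /ℕ n) (j /ℕ n) (+ n) ⟩
    (i /ℕ n - j /ℕ n) * + n ∎)
    where open ≡.≡-Reasoning

  multiple<⇒≡0 : ∀ {k n} → n ∣ᵤ k → k ℕ.< n → k ≡ 0
  multiple<⇒≡0 {zero}  _   _   = refl
  multiple<⇒≡0 {suc k} n∣k k<n = contradiction n∣k (ℕ.>⇒∤ k<n)

  -- By Euclid's lemma the prime divides a factor of a² - b² = (a + b)(a - b). Both factors have
  -- absolute value at most 2h, which is below the prime, so that factor is 0; if it is a + b, both
  -- numbers are 0.
  squares-incongruent : ∀ {h a b} → Prime (suc (h ℕ.+ h)) → a ℕ.≤ h → b ℕ.≤ h →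
    + suc (h ℕ.+ h) ∣ + a * + a - + b * + b → a ≡ b
  squares-incongruent {h} {a} {b} p-prime a≤h b≤h p∣a²-b²
    with euclidsLemma ∣ + a + + b ∣ ∣ + a - + b ∣ p-prime
           (≡.subst (suc (h ℕ.+ h) ∣ᵤ_) (ℤ.abs-* (+ a + + b) (+ a - + b)) (∣⇒∣ᵤ (≡.subst (+ suc (h ℕ.+ h) ∣_)
             (solve 2 (λ a b → a :* a :- b :* b := (a :+ b) :* (a :- b)) refl (+ a) (+ b)) p∣a²-b²)))
  ... | inj₁ p∣a+b = ≡.trans (ℕ.m+n≡0⇒m≡0 a a+b≡0) (≡.sym (ℕ.m+n≡0⇒n≡0 a a+b≡0))
    where a+b≡0 = multiple<⇒≡0 p∣a+b (s≤s (ℕ.+-mono-≤ a≤h b≤h))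
  ... | inj₂ p∣a-b = ℤ.+-injective (ℤ.i-j≡0⇒i≡j (+ a) (+ b) (ℤ.∣i∣≡0⇒i≡0
      (multiple<⇒≡0 p∣a-b (s≤s (ℕ.≤-trans (ℤ.∣i-j∣≤∣i∣+∣j∣ (+ a) (+ b)) (ℕ.+-mono-≤ a≤h b≤h))))))

  -- The h + 1 squares and the h + 1 values -(1 + b²) cannot be pairwise
  -- incongruent modulo 2h + 1.
  minusOne-sumOfTwoSquares : ∀ {h} → Prime (suc (h ℕ.+ h)) →
    ∃₂ λ a b → a ℕ.≤ h × b ℕ.≤ h × suc (h ℕ.+ h) ∣ᵤ suc (sq a ℕ.+ sq b)
  minusOne-sumOfTwoSquares {h} p-prime =
    let i , j , i<j , fi≡fj = Fin.pigeonhole (ℕ.≤-reflexive (≡.cong suc (≡.sym (ℕ.+-suc h h)))) residue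
    in collision (splitAt (suc h) i) (splitAt (suc h) j) (Fin.<⇒≢ i<j ∘ splitAt-injective i j)
         (%ℕ-≡⇒∣ (value (splitAt (suc h) i)) (value (splitAt (suc h) j)) (Fin.fromℕ<-injective _ _ _ _ fi≡fj))
    where
    p = suc (h ℕ.+ h)
    value : Fin (suc h) ⊎ Fin (suc h) → ℤ
    value (inj₁ a) = + toℕ a * + toℕ a
    value (inj₂ b) = - (1ℤ + + toℕ b * + toℕ b)
    residue : Fin (suc h ℕ.+ suc h) → Fin p
    residue i = fromℕ< (n%ℕd<d (value (splitAt (suc h) i)) p)
    splitAt-injective : ∀ i j → splitAt (suc h) i ≡ splitAt (suc h) j → i ≡ j
    splitAt-injective i j eq = ≡.trans (≡.sym (Fin.join-splitAt (suc h) (suc h) i))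
      (≡.trans (≡.cong (join (suc h) (suc h)) eq) (Fin.join-splitAt (suc h) (suc h) j))
    equal : ∀ a b → + p ∣ + toℕ a * + toℕ a - + toℕ b * + toℕ b → a ≡ b
    equal a b = Fin.toℕ-injective ∘ squares-incongruent p-prime (Fin.toℕ≤pred[n] a) (Fin.toℕ≤pred[n] b)
    mixed : ∀ a b → + p ∣ value (inj₁ a) - value (inj₂ b) → ∃₂ λ a b → a ℕ.≤ h × b ℕ.≤ h × p ∣ᵤ suc (sq a ℕ.+ sq b)
    mixed a b p∣ = toℕ a , toℕ b , Fin.toℕ≤pred[n] a , Fin.toℕ≤pred[n] b , ∣⇒∣ᵤ (≡.subst (+ p ∣_) (begin
      + toℕ a * + toℕ a - - (1ℤ + + toℕ b * + toℕ b)
        ≡⟨ solve 2 (λ a b → a :* a :- (:- (con 1ℤ :+ b :* b)) := con 1ℤ :+ (a :* a :+ b :* b)) refl (+ toℕ a) (+ toℕ b) ⟩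
      1ℤ + (+ toℕ a * + toℕ a + + toℕ b * + toℕ b)
        ≡⟨ ≡.cong₂ (λ x y → 1ℤ + (x + y)) (i*i≡∣i∣*∣i∣ (+ toℕ a)) (i*i≡∣i∣*∣i∣ (+ toℕ b)) ⟩
      + suc (sq (toℕ a) ℕ.+ sq (toℕ b)) ∎) p∣)
      where open ≡.≡-Reasoning
    -- Within one family congruent values have equal indices, so a collision pairs a² with -(1 +
    -- b²), and their difference is 1 + a² + b².
    collision : ∀ s t → s ≢ t → + p ∣ value s - value t → ∃₂ λ a b → a ℕ.≤ h × b ℕ.≤ h × p ∣ᵤ suc (sq a ℕ.+ sq b)
    collision (inj₁ a) (inj₁ b) s≢t p∣ = contradiction (≡.cong inj₁ (equal a b p∣)) s≢t
    collision (inj₁ a) (inj₂ b) s≢t p∣ = mixed a b p∣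
    collision (inj₂ b) (inj₁ a) s≢t p∣ = mixed a b (≡.subst (+ p ∣_)
      (solve 2 (λ x y → :- (x :- y) := y :- x) refl (value (inj₂ b)) (value (inj₁ a))) (∣m⇒∣-m p∣))
    collision (inj₂ a) (inj₂ b) s≢t p∣ = contradiction (≡.cong inj₂ (≡.sym (equal b a (≡.subst (+ p ∣_)
      (solve 2 (λ a b → (:- (con 1ℤ :+ a :* a)) :- (:- (con 1ℤ :+ b :* b)) := b :* b :- a :* a) refl (+ toℕ a) (+ toℕ b)) p∣)))) s≢t

  -- Write 1 + a² + b² = m p with a, b ≤ h; a fourth square 0² completes the sum. The cofactor is
  -- nonzero because the left side is, and m p ≤ 1 + 2h² < (2h + 1)² = p² bounds it by `p`.
  oddPrime-multiple : ∀ {h} → Prime (suc (h ℕ.+ h)) →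
    ∃ λ m → 0 ℕ.< m × m ℕ.< suc (h ℕ.+ h) × FourSquares (+ m * + suc (h ℕ.+ h))
  oddPrime-multiple {zero} p-prime = contradiction p-prime ¬prime[1]
  oddPrime-multiple {h@(suc _)} p-prime with minusOne-sumOfTwoSquares {h} p-prime
  ... | a , b , a≤h , b≤h , ℕ.divides m@(suc _) 1+a²+b²≡mp = m , z<s , ℕ.*-cancelʳ-< p m p mp<pp
      , + a , + b , 1ℤ , 0ℤ , (begin
        + a * + a + + b * + b + 1ℤ + 0ℤ     ≡⟨ solve 2 (λ x y → x :+ y :+ con 1ℤ :+ con 0ℤ := con 1ℤ :+ (x :+ y)) refl (+ a * + a) (+ b * + b) ⟩
        1ℤ + (+ a * + a + + b * + b)        ≡⟨ ≡.cong₂ (λ x y → 1ℤ + (x + y)) (i*i≡∣i∣*∣i∣ (+ a)) (i*i≡∣i∣*∣i∣ (+ b)) ⟩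
        + suc (sq a ℕ.+ sq b)               ≡⟨ ≡.cong +_ 1+a²+b²≡mp ⟩
        + (m ℕ.* p)                         ≡⟨ ℤ.pos-* m p ⟩
        + m * + p                           ∎)
    where
    open ≡.≡-Reasoning
    p = suc (h ℕ.+ h)
    mp<pp : m ℕ.* p ℕ.< p ℕ.* p
    mp<pp = ≡.subst₂ ℕ._<_ 1+a²+b²≡mp
      -- The excess of p² over 1 + 2h² is written with `h` as its leading summand: `h` is a
      -- successor here, so `z<s` proves the excess positive.
      (ℕˢ.solve 1 (λ h → let p = ℕˢ.con 1 ℕˢ.:+ (h ℕˢ.:+ h); h² = h ℕˢ.:* h in
        (ℕˢ.con 1 ℕˢ.:+ (h² ℕˢ.:+ h²)) ℕˢ.:+ (h ℕˢ.:+ (h ℕˢ.:+ h ℕˢ.:+ h ℕˢ.:+ h² ℕˢ.:+ h²)) ℕˢ.:= p ℕˢ.:* p) refl h)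
      (ℕ.≤-<-trans (s≤s (ℕ.+-mono-≤ (sq-mono a≤h) (sq-mono b≤h))) (ℕ.m<m+n (suc (sq h ℕ.+ sq h)) z<s))

  -- From primes to all natural numbers and to residues.

  fourSquares-prime : ∀ {p} → Prime p → FourSquares (+ p)
  fourSquares-prime {p} p-prime with p ℕ.% 2 | p ℕ./ 2 | m≡m%n+[m/n]*n p 2 | m%n<n p 2
  -- An even prime is 2 = 1² + 1² + 0² + 0².
  ... | 0 | h | refl | _ with inj₂ 2≡p ← prime⇒irreducible p-prime (ℕ.divides h refl) =
    ≡.subst (FourSquares ∘ +_) 2≡p (1ℤ , 1ℤ , 0ℤ , 0ℤ , refl)
  ... | 1 | h | p≡1+2h | _ with refl ← ≡.trans p≡1+2h (≡.cong suc (ℕˢ.solve 1 (λ h → h ℕˢ.:* ℕˢ.con 2 ℕˢ.:= h ℕˢ.:+ h) refl h)) =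
    let m , 0<m , m<p , ∑≡mp = oddPrime-multiple {h} p-prime in multiple⇒fourSquares p-prime 0<m m<p ∑≡mp
  ... | suc (suc _) | _ | _ | s≤s (s≤s ())

  lagrange : ∀ n → FourSquares (+ n)
  lagrange zero = 0ℤ , 0ℤ , 0ℤ , 0ℤ , refl
  lagrange n@(suc _) = ≡.subst (FourSquares ∘ +_) (≡.sym isFactorisation) (fourSquares-product factorsPrime)
    where
    open PrimeFactorisation (factorise n)
    fourSquares-product : ∀ {ps} → All Prime ps → FourSquares (+ product ps)
    fourSquares-product [] = 1ℤ , 0ℤ , 0ℤ , 0ℤ , refl
    fourSquares-product (_∷_ {p} {ps} p-prime ps-prime) = ≡.subst FourSquares (≡.sym (ℤ.pos-* p (product ps)))
      (fourSquares-* (fourSquares-prime p-prime) (fourSquares-product ps-prime))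

  -- The representative `u` may be negative, so Lagrange's theorem is applied to its remainder,
  -- which is a natural number congruent to it.
  lagrange-ℤ/n : ∀ n .{{_ : NonZero n}} u → IsSumOfFourSquares (ℤ/ n) u
  lagrange-ℤ/n n u with x₁ , x₂ , x₃ , x₄ , ∑≡r ← lagrange (u %ℕ n) =
    x₁ , x₂ , x₃ , x₄ , divides (- (u /ℕ n)) (begin
      norm x₁ x₂ x₃ x₄ - u                      ≡⟨ ≡.cong₂ _-_ ∑≡r (a≡a%ℕn+[a/ℕn]*n u n) ⟩
      + (u %ℕ n) - (+ (u %ℕ n) + u /ℕ n * + n)  ≡⟨ solve 3 (λ r q n → r :- (r :+ q :* n) := (:- q) :* n) refl (+ (u %ℕ n)) (u /ℕ n) (+ n) ⟩
      - (u /ℕ n) * + n                          ∎)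
    where open ≡.≡-Reasoning

module SphereProperties {c ℓ} (R : CommutativeRing c ℓ) where
  open CommutativeRing R
  open IntegerCoefficients R
  open RawGauss rawRing using (gaussRawRing; normSq)
  open RawMaps rawRing
  open RawMatrix gaussRawRing using (Matrix; _*ₘ_; _≈ₘ_; 1ₘ)
  private
    module S   = RawGroup (𝒮-rawGroup R)
    module SU₂ = Group (SU₂ R)
    module U₂  = Group (U₂ R)
    module Units = Group (units *-monoid)
    module SO₄ = Group (SO₄ R)
    module M₂ = Monoid (MatrixMonoid.matrixMonoid (Gaussian.gaussianRing R) 2)

  -- The bijection θ and the group structure transported along it.

  θ-cong : Congruent S._≈_ SU₂._≈_ (θ R)
  θ-cong (p₁ , p₂ , p₃ , p₄) = λ where
    0F 0F → p₁ , p₂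
    0F 1F → -‿cong p₃ , p₄
    1F 0F → p₃ , p₄
    1F 1F → p₁ , -‿cong p₂

  θ-injective : Injective S._≈_ SU₂._≈_ (θ R)
  θ-injective h = proj₁ (h 0F 0F) , proj₂ (h 0F 0F) , proj₁ (h 1F 0F) , proj₂ (h 1F 0F)

  -- `θ⁻¹` reads only the first column; the shape `form α β` then determines the second column.
  θ∘θ⁻¹ : ∀ U → θ R (θ⁻¹ R U) SU₂.≈ U
  θ∘θ⁻¹ (M , α , β , M≈ , _) = λ where
    0F 0F → refl , refl
    0F 1F → trans (-‿cong (proj₁ (M≈ 1F 0F))) (sym (proj₁ (M≈ 0F 1F)))
          , trans (trans (proj₂ (M≈ 1F 0F)) (prove (im β Vec.∷ Vec.[]) (var 0F) (:- :- var 0F) refl))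
                  (sym (proj₂ (M≈ 0F 1F)))
    1F 0F → refl , refl
    1F 1F → trans (proj₁ (M≈ 0F 0F)) (sym (proj₁ (M≈ 1F 1F)))
          , trans (-‿cong (proj₂ (M≈ 0F 0F))) (sym (proj₂ (M≈ 1F 1F)))

  θ-inverse : Inverseᵇ S._≈_ SU₂._≈_ (θ R) (θ⁻¹ R)
  θ-inverse = (λ {U} {X} X≈ → SU₂.trans {θ R X} {θ R (θ⁻¹ R U)} {U} (θ-cong {X} {θ⁻¹ R U} X≈) (θ∘θ⁻¹ U))
            , (λ {X} {U} U≈ → θ-injective {θ⁻¹ R U} {X} (SU₂.trans {θ R (θ⁻¹ R U)} {U} {θ R X} (θ∘θ⁻¹ U) U≈))

  θ-bijective : Bijective S._≈_ SU₂._≈_ (θ R)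
  θ-bijective = (λ {X} {Y} → θ-injective {X} {Y}) , λ U → θ⁻¹ R U , λ {X} → proj₁ θ-inverse {U} {X}

  -- Product, unit and inverse on the sphere are `θ⁻¹` of those in `SU₂`, so each of the three laws
  -- is an instance of `θ∘θ⁻¹`.
  θ-isGroupMonomorphism : GroupMorphisms.IsGroupMonomorphism (𝒮-rawGroup R) SU₂.rawGroup (θ R)
  θ-isGroupMonomorphism = record
    { isGroupHomomorphism = record
      { isMonoidHomomorphism = record
        { isMagmaHomomorphism = record
          { isRelHomomorphism = record { cong = λ {X} {Y} → θ-cong {X} {Y} }
          ; homo = λ X Y → θ∘θ⁻¹ (θ R X SU₂.∙ θ R Y)
          }
        ; ε-homo = θ∘θ⁻¹ SU₂.ε
        }
      ; ⁻¹-homo = λ X → θ∘θ⁻¹ (θ R X SU₂.⁻¹)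
      }
    ; injective = λ {X} {Y} → θ-injective {X} {Y}
    }

  ⊕-isGroup : IsGroup S._≈_ (_⊕_ R) S.ε S._⁻¹
  ⊕-isGroup = GroupMonomorphism.isGroup θ-isGroupMonomorphism SU₂.isGroup

  private
    module Pᵍ (n : ℕ) where
      open RawGauss (polynomials n) using () renaming (gaussRawRing to gaussₚ) public
      open RawMatrix gaussₚ using () renaming (_*ₘ_ to _⊗_; 1ₘ to 𝟙) public
      open RawGauss (polynomials n) using () renaming (normSq to normSqₚ; form to formₚ) public
      open RawMaps (polynomials n) using () renaming (θ-matrix to θₚ; φ-matrix to φₚ) public
      normₚ : RawMatrix.Matrix gaussₚ 2 2 → Polynomial n
      normₚ M = re (normSqₚ (M 0F 0F) (M 1F 0F))

  ⊕-nonCommutative : ¬ IsSquare R (- 1#) → ¬ Commutative S._≈_ (_⊕_ R)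
  ⊕-nonCommutative -1-nonSquare comm = -1-nonSquare (1# , (begin
    1# * 1#     ≈⟨ *-identityˡ 1# ⟩
    -- The fourth coordinate is 1 for j ⊕ i and -1 for i ⊕ j.
    1#          ≈⟨ prove Vec.[] (im ((θⱼ ⊗ θᵢ) 1F 0F)) (con 1ℤ) refl ⟨
    𝒮.x₄ (_⊕_ R j i) ≈⟨ proj₂ (proj₂ (proj₂ (comm i j))) ⟨
    𝒮.x₄ (_⊕_ R i j) ≈⟨ prove Vec.[] (im ((θᵢ ⊗ θⱼ) 1F 0F)) (:- con 1ℤ) refl ⟩
    - 1#        ∎))
    where
    open ≈-Reasoning setoid
    open Pᵍ 0
    θᵢ = θₚ (con 0ℤ) (con 1ℤ) (con 0ℤ) (con 0ℤ)
    θⱼ = θₚ (con 0ℤ) (con 0ℤ) (con 1ℤ) (con 0ℤ)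
    νₚ : (x₁ x₂ x₃ x₄ : Polynomial 0) → Polynomial 0
    νₚ x₁ x₂ x₃ x₄ = x₁ :* x₁ :+ x₂ :* x₂ :+ x₃ :* x₃ :+ x₄ :* x₄
    i j : 𝒮 R
    i = record { x₁ = 0# ; x₂ = 1# ; x₃ = 0# ; x₄ = 0#
               ; unit = prove Vec.[] (νₚ (con 0ℤ) (con 1ℤ) (con 0ℤ) (con 0ℤ)) (con 1ℤ) refl }
    j = record { x₁ = 0# ; x₂ = 0# ; x₃ = 1# ; x₄ = 0#
               ; unit = prove Vec.[] (νₚ (con 0ℤ) (con 0ℤ) (con 1ℤ) (con 0ℤ)) (con 1ℤ) refl }

  open Algebra.Definitions _≈_ using (Invertible)

  private
    2×2 : ∀ {p} {P : Fin 2 → Fin 2 → Set p} → P 0F 0F → P 0F 1F → P 1F 0F → P 1F 1F → ∀ i j → P i j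
    2×2 a b c d = λ where
      0F 0F → a ; 0F 1F → b
      1F 0F → c ; 1F 1F → d

    4×4 : ∀ {p} {P : Fin 4 → Fin 4 → Set p} →
      P 0F 0F → P 0F 1F → P 0F 2F → P 0F 3F → P 1F 0F → P 1F 1F → P 1F 2F → P 1F 3F →
      P 2F 0F → P 2F 1F → P 2F 2F → P 2F 3F → P 3F 0F → P 3F 1F → P 3F 2F → P 3F 3F → ∀ i j → P i j
    4×4 a b c d e f g h i j k l m n o p = λ where
      0F 0F → a ; 0F 1F → b ; 0F 2F → c ; 0F 3F → d
      1F 0F → e ; 1F 1F → f ; 1F 2F → g ; 1F 3F → h
      2F 0F → i ; 2F 1F → j ; 2F 2F → k ; 2F 3F → l
      3F 0F → m ; 3F 1F → n ; 3F 2F → o ; 3F 3F → p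

    coordinates : 𝒮 R → Vec Carrier 4
    coordinates X = x₁ Vec.∷ x₂ Vec.∷ x₃ Vec.∷ x₄ Vec.∷ Vec.[]
      where open 𝒮 X

  -- The embedding φ into the special orthogonal group.

  φ-cong : Congruent S._≈_ SO₄._≈_ (φ R)
  φ-cong (p₁ , p₂ , p₃ , p₄) = 4×4
    p₁ p₂ p₃ p₄
    (-‿cong p₂) p₁ p₄ (-‿cong p₃)
    (-‿cong p₃) (-‿cong p₄) p₁ p₂
    (-‿cong p₄) p₃ (-‿cong p₂) p₁

  φ-∙-homo : ∀ X Y → φ R (_⊕_ R X Y) SO₄.≈ φ R X SO₄.∙ φ R Y
  φ-∙-homo X Y = 4×4
    (e 0F 0F refl) (e 0F 1F refl) (e 0F 2F refl) (e 0F 3F refl)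
    (e 1F 0F refl) (e 1F 1F refl) (e 1F 2F refl) (e 1F 3F refl)
    (e 2F 0F refl) (e 2F 1F refl) (e 2F 2F refl) (e 2F 3F refl)
    (e 3F 0F refl) (e 3F 1F refl) (e 3F 2F refl) (e 3F 3F refl)
    where
    open Pᵍ 8
    open RawMatrix (polynomials 8) using () renaming (_*ₘ_ to _⊠_)
    -- The symbolic product θ(X) θ(Y); the coordinates of X ⊕ Y are read off its first column, as in
    -- `θ⁻¹`.
    Z = θₚ (var 0F) (var 1F) (var 2F) (var 3F) ⊗ θₚ (var 4F) (var 5F) (var 6F) (var 7F)
    e = λ i j → prove (coordinates X Vec.++ coordinates Y)
      (φₚ (re (Z 0F 0F)) (im (Z 0F 0F)) (re (Z 1F 0F)) (im (Z 1F 0F)) i j)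
      ((φₚ (var 0F) (var 1F) (var 2F) (var 3F) ⊠ φₚ (var 4F) (var 5F) (var 6F) (var 7F)) i j)

  φ-ε-homo : φ R S.ε SO₄.≈ SO₄.ε
  φ-ε-homo = 4×4 refl refl refl refl e refl refl e e e refl refl e refl e refl
    where e = prove Vec.[] (:- con 0ℤ) (con 0ℤ) refl

  φ-isGroupMonomorphism : GroupMorphisms.IsGroupMonomorphism (𝒮-rawGroup R) SO₄.rawGroup (φ R)
  φ-isGroupMonomorphism = record
    { isGroupHomomorphism = record
      { isMonoidHomomorphism = record
        { isMagmaHomomorphism = record
          { isRelHomomorphism = record { cong = λ {X} {Y} → φ-cong {X} {Y} }
          ; homo = φ-∙-homo
          }
        ; ε-homo = φ-ε-homo
        }
      ; ⁻¹-homo = φ-⁻¹-homo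
      }
    ; injective = λ h → h 0F 0F , h 0F 1F , h 0F 2F , h 0F 3F
    }
    where
    open Algebra.Properties.Group (SO₄ R) using (inverseˡ-unique)
    -- Applying φ to the law for left inverses yields a left inverse of φ(X), and left inverses in a
    -- group are unique.
    φ-⁻¹-homo : ∀ X → φ R (X S.⁻¹) SO₄.≈ φ R X SO₄.⁻¹
    φ-⁻¹-homo X = inverseˡ-unique (φ R (X S.⁻¹)) (φ R X)
      (SO₄.trans {φ R (X S.⁻¹) SO₄.∙ φ R X} {φ R (_⊕_ R (X S.⁻¹) X)} {SO₄.ε}
        (SO₄.sym {φ R (_⊕_ R (X S.⁻¹) X)} {φ R (X S.⁻¹) SO₄.∙ φ R X} (φ-∙-homo (X S.⁻¹) X))
        (SO₄.trans {φ R (_⊕_ R (X S.⁻¹) X)} {φ R S.ε} {SO₄.ε}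
          (φ-cong {_⊕_ R (X S.⁻¹) X} {S.ε} (IsGroup.inverseˡ ⊕-isGroup X)) φ-ε-homo))

  -- The exact sequence through the unitary group.

  SU₂⇒U₂ : SU₂.Carrier → U₂.Carrier
  SU₂⇒U₂ U@(M , α , β , M≈ , _) = M , (α , β , M≈) , proj₁ (U SU₂.⁻¹) , SU₂.inverseˡ U , SU₂.inverseʳ U

  -- On matrices `form α β` this is the determinant αᾱ + ββ̄, whose imaginary part vanishes
  -- identically; taking the real part places it in the base ring.
  norm : Matrix 2 2 → Carrier
  norm M = re (normSq (M 0F 0F) (M 1F 0F))

  norm-cong : ∀ {M N} → M ≈ₘ N → norm M ≈ norm N
  norm-cong M≈N =
    +-cong (+-cong (*-cong p p) (-‿cong (*-cong q (-‿cong q)))) (+-cong (*-cong r r) (-‿cong (*-cong s (-‿cong s))))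
    where
    p = proj₁ (M≈N 0F 0F)
    q = proj₂ (M≈N 0F 0F)
    r = proj₁ (M≈N 1F 0F)
    s = proj₂ (M≈N 1F 0F)

  -- The first column of a product involves the second column of the left factor, so the factors are
  -- replaced by their forms before the solver checks the identity in eight coordinates.
  norm-* : ∀ U V → norm (proj₁ (U U₂.∙ V)) ≈ norm (proj₁ U) * norm (proj₁ V)
  norm-* (M , (α , β , M≈) , _) (N , (γ , δ , N≈) , _) = begin
    norm (M *ₘ N)                           ≈⟨ norm-cong (M₂.∙-cong {M} {A} {N} {B} M≈ N≈) ⟩
    norm (A *ₘ B)                           ≈⟨ prove ρ (normₚ (Aₚ ⊗ Bₚ)) (normₚ Aₚ :* normₚ Bₚ) refl ⟩
    norm A * norm B                         ≈⟨ *-cong (norm-cong M≈) (norm-cong N≈) ⟨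
    norm M * norm N                         ∎
    where
    open ≈-Reasoning setoid
    open Pᵍ 8
    open RawGauss rawRing using (form)
    A = form α β
    B = form γ δ
    Aₚ = formₚ (var 0F +i var 1F) (var 2F +i var 3F)
    Bₚ = formₚ (var 4F +i var 5F) (var 6F +i var 7F)
    ρ = re α Vec.∷ im α Vec.∷ re β Vec.∷ im β Vec.∷ re γ Vec.∷ im γ Vec.∷ re δ Vec.∷ im δ Vec.∷ Vec.[]

  norm-1 : norm 1ₘ ≈ 1#
  norm-1 = prove Vec.[] (normₚ 𝟙) (con 1ℤ) refl
    where open Pᵍ 0

  norm-θ : ∀ X → norm (proj₁ (θ R X)) ≈ 1#
  norm-θ X = trans (prove (coordinates X) (normₚ (θₚ (var 0F) (var 1F) (var 2F) (var 3F)))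
      (var 0F :* var 0F :+ var 1F :* var 1F :+ var 2F :* var 2F :+ var 3F :* var 3F) refl) (𝒮.unit X)
    where open Pᵍ 4

  -- Taking the norm of the inverse matrix as the inverse of the norm makes preservation of inverses
  -- hold by `refl`.
  normᵤ : U₂.Carrier → Units.Carrier
  normᵤ U = norm (proj₁ U) , norm (proj₁ (U U₂.⁻¹))
    , trans (sym (norm-* (U U₂.⁻¹) U)) (trans (norm-cong (U₂.inverseˡ U)) norm-1)
    , trans (sym (norm-* U (U U₂.⁻¹))) (trans (norm-cong (U₂.inverseʳ U)) norm-1)

  -- The same matrix serves, with the form already supplied by `U₂`. Propositional equality of the
  -- matrices allows `kernel⊆image` to match on it.
  norm≈1⇒∈SU₂ : (U : U₂.Carrier) → norm (proj₁ U) ≈ 1# → ∃ λ V → proj₁ (SU₂⇒U₂ V) ≡ proj₁ U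
  norm≈1⇒∈SU₂ (M , (α , β , M≈) , _) p = (M , α , β , M≈ , trans (sym (norm-cong M≈)) p
    , prove (re α Vec.∷ im α Vec.∷ re β Vec.∷ im β Vec.∷ Vec.[])
        (im (normSqₚ (var 0F +i var 1F) (var 2F +i var 3F))) (con 0ℤ) refl)
    , ≡.refl
    where open Pᵍ 4

  -- Supplies preimages under the norm: a representation of a unit as four squares is an invertible
  -- matrix of that norm.
  θ-U₂ : (x₁ x₂ x₃ x₄ : Carrier) {u : Carrier} → Invertible 1# _*_ u →
    x₁ * x₁ + x₂ * x₂ + x₃ * x₃ + x₄ * x₄ ≈ u → U₂.Carrier
  θ-U₂ x₁ x₂ x₃ x₄ {u} (v , vu , uv) ν≈u = Θ
    , ((x₁ +i x₂) , (x₃ +i x₄)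
      , 2×2 (refl , refl) (refl , prove ρ x₄ₚ (:- (:- x₄ₚ)) refl) (refl , refl) (refl , refl))
    , Θ⁻¹
    , (λ i j → G.trans {(Θ⁻¹ *ₘ Θ) i j} {ν i j} {1ₘ i j} (2×2 {P = λ i j → (Θ⁻¹ *ₘ Θ) i j G.≈ ν i j}
         (l 0F 0F (refl , refl)) (l 0F 1F (refl , refl)) (l 1F 0F (refl , refl)) (l 1F 1F (refl , refl)) i j) (scale i j))
    , (λ i j → G.trans {(Θ *ₘ Θ⁻¹) i j} {ν i j} {1ₘ i j} (2×2 {P = λ i j → (Θ *ₘ Θ⁻¹) i j G.≈ ν i j}
         (r 0F 0F (refl , refl)) (r 0F 1F (refl , refl)) (r 1F 0F (refl , refl)) (r 1F 1F (refl , refl)) i j) (scale i j))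
    where
    open Pᵍ 5
    module G = CommutativeRing (Gaussian.gaussianRing R)
    ρ = v Vec.∷ x₁ Vec.∷ x₂ Vec.∷ x₃ Vec.∷ x₄ Vec.∷ Vec.[]
    vₚ = var 0F
    x₁ₚ = var 1F
    x₂ₚ = var 2F
    x₃ₚ = var 3F
    x₄ₚ = var 4F
    Θ Θ⁻¹ ν : Matrix 2 2
    Θ = θ-matrix x₁ x₂ x₃ x₄
    -- The conjugate quaternion scaled by v = u⁻¹: its product with `Θ` on either side is the
    -- identity times v (x₁² + x₂² + x₃² + x₄²), and this scalar is v u = 1.
    Θ⁻¹ = θ-matrix (v * x₁) (v * - x₂) (v * - x₃) (v * - x₄)
    s = v * (x₁ * x₁ + x₂ * x₂ + x₃ * x₃ + x₄ * x₄)
    ν i j = s * re (1ₘ i j) +i s * im (1ₘ i j)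
    Θₚ = θₚ x₁ₚ x₂ₚ x₃ₚ x₄ₚ
    Θ⁻¹ₚ = θₚ (vₚ :* x₁ₚ) (vₚ :* :- x₂ₚ) (vₚ :* :- x₃ₚ) (vₚ :* :- x₄ₚ)
    sₚ = vₚ :* (x₁ₚ :* x₁ₚ :+ x₂ₚ :* x₂ₚ :+ x₃ₚ :* x₃ₚ :+ x₄ₚ :* x₄ₚ)
    νₚ : Fin 2 → Fin 2 → Gauss (Polynomial 5)
    νₚ i j = sₚ :* re (𝟙 i j) +i sₚ :* im (𝟙 i j)
    l = λ i j → Gaussian.proveᵍ R ρ ((Θ⁻¹ₚ ⊗ Θₚ) i j) (νₚ i j)
    r = λ i j → Gaussian.proveᵍ R ρ ((Θₚ ⊗ Θ⁻¹ₚ) i j) (νₚ i j)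
    s≈1 = trans (*-congˡ ν≈u) vu
    scale : ∀ i j → ν i j G.≈ 1ₘ i j
    scale i j = trans (*-congʳ s≈1) (*-identityˡ _) , trans (*-congʳ s≈1) (*-identityˡ _)

  normᵤ-surjective : (∀ u → IsSumOfFourSquares R u) → Surjective U₂._≈_ Units._≈_ normᵤ
  normᵤ-surjective four-squares (u , u⁻¹) with x₁ , x₂ , x₃ , x₄ , ν≈u ← four-squares u =
    θ-U₂ x₁ x₂ x₃ x₄ u⁻¹ ν≈u , λ U≈ → trans (norm-cong U≈)
      (trans (prove (x₁ Vec.∷ x₂ Vec.∷ x₃ Vec.∷ x₄ Vec.∷ Vec.[]) (normₚ (θₚ (var 0F) (var 1F) (var 2F) (var 3F)))
        (var 0F :* var 0F :+ var 1F :* var 1F :+ var 2F :* var 2F :+ var 3F :* var 3F) refl) ν≈u)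
    where open Pᵍ 4

  U₂-sequence : (∀ u → IsSumOfFourSquares R u) → ShortExactSequence (𝒮-rawGroup R) U₂.rawGroup Units.rawGroup
  U₂-sequence four-squares = record
    { f = SU₂⇒U₂ ∘ θ R
    ; g = normᵤ
    ; f-homomorphism = record
      { isMonoidHomomorphism = record
        { isMagmaHomomorphism = record
          { isRelHomomorphism = record { cong = λ {X} {Y} → θ-cong {X} {Y} }
          ; homo = Θ.homo
          }
        ; ε-homo = Θ.ε-homo
        }
      ; ⁻¹-homo = Θ.⁻¹-homo
      }
    ; g-homomorphism = record
      { isMonoidHomomorphism = record
        { isMagmaHomomorphism = record
          { isRelHomomorphism = record { cong = norm-cong }
          ; homo = norm-*
          }
        ; ε-homo = norm-1
        }
      ; ⁻¹-homo = λ _ → refl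
      }
    ; f-injective = λ {X} {Y} → θ-injective {X} {Y}
    ; exact = λ U → mk⇔ (kernel⊆image U) (λ { (X , θX≈U) → trans (sym (norm-cong θX≈U)) (norm-θ X) })
    ; g-surjective = normᵤ-surjective four-squares
    }
    where
    open GroupMorphisms.IsGroupMonomorphism θ-isGroupMonomorphism using (isGroupHomomorphism)
    module Θ = GroupMorphisms.IsGroupHomomorphism isGroupHomomorphism
    kernel⊆image : (U : U₂.Carrier) → norm (proj₁ U) ≈ 1# → ∃ λ X → SU₂⇒U₂ (θ R X) U₂.≈ U
    kernel⊆image U p with V , ≡.refl ← norm≈1⇒∈SU₂ U p = θ⁻¹ R V , θ∘θ⁻¹ V

proposition1p1 : ∀ {c ℓ} →
  ((R : CommutativeRing c ℓ) →
    let module R = CommutativeRing R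
        module S = RawGroup (𝒮-rawGroup R)
        module SU₂ = Group (SU₂ R)
    in
    ¬ IsSquare R (R.- R.1#) →
      ( Bijective S._≈_ SU₂._≈_ (θ R)
      × Inverseᵇ S._≈_ SU₂._≈_ (θ R) (θ⁻¹ R)
      × IsGroup S._≈_ (_⊕_ R) S.ε S._⁻¹
      × ¬ Commutative S._≈_ (_⊕_ R) )
    × GroupMorphisms.IsGroupMonomorphism (𝒮-rawGroup R) (Group.rawGroup (SO₄ R)) (φ R) )
  × ((n : ℕ) .{{_ : NonZero n}} →
    let module ℤ/n = CommutativeRing (ℤ/ n) in
    ¬ IsSquare (ℤ/ n) (ℤ/n.- ℤ/n.1#) →
    ShortExactSequence (𝒮-rawGroup (ℤ/ n)) (Group.rawGroup (U₂ (ℤ/ n))) (Group.rawGroup (units ℤ/n.*-monoid)))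
proposition1p1 =
    (λ R -1-nonSquare → let open SphereProperties R in
      (θ-bijective , θ-inverse , ⊕-isGroup , ⊕-nonCommutative -1-nonSquare) , φ-isGroupMonomorphism)
  , (λ n _ → SphereProperties.U₂-sequence (ℤ/ n) (FourSquareTheorem.lagrange-ℤ/n n))
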